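{- Let $G$ be a unicyclic graph of order $n\ge 5$ not isomorphic to the cycle $C_n$. Then $\operatorname{CS}(G,x)\preceq\operatorname{CS}(U_n,x)$.
   Context: All graphs are finite, simple and undirected. A unicyclic graph is a connected graph $G$ with $|V(G)|=|E(G)|$. $U_n=(K_2\cup\overline{K_{n-3}})\vee K_1$ (a triangle $cab$ with $n-3$ pendant leaves attached at $c$). A connected set of $G$ is a subset of $V(G)$ inducing a connected subgraph; $S_k(G)$ is the number of connected sets of size $k$, and $\operatorname{CS}(G,x)=\sum_{k=1}^{n}S_k(G)x^k$. For polynomials $A(x)=\sum_{k=0}^n a_kx^k$, $B(x)=\sum_{k=0}^m b_kx^k$, write $B(x)\preceq A(x)$ if $m\le n$ and $b_k\le a_k$ for all $k$. -}

module Defs where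

open import Data.Bool using (Bool; true; false; _∧_; _∨_; not; if_then_else_)
open import Data.Nat using (ℕ; zero; suc; _+_; _≡ᵇ_; _≤_)
open import Data.Fin using (Fin; toℕ)
open import Data.Fin.Permutation using (Permutation′; _⟨$⟩ʳ_)
open import Data.Vec using (Vec; []; _∷_; lookup)
open import Data.List using (List; []; _∷_; map; _++_; length; filter; allFin)
open import Data.Bool.ListAction using (any; all)
open import Data.Product using (Σ)
open import Relation.Binary.PropositionalEquality using (_≡_)
open import Relation.Nullary using (¬_)
open import Relation.Nullary.Decidable using (does)
open import Data.Bool using (T)
open import Data.Bool.Properties using (T?)

record Graph (n : ℕ) : Set where
  field
    adj   : Fin n → Fin n → Bool
    sym   : ∀ i j → adj i j ≡ adj j i
    irrfl : ∀ i → adj i i ≡ false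
open Graph public

Adjacency : ℕ → Set
Adjacency n = Fin n → Fin n → Bool

Subset : ℕ → Set
Subset n = Vec Bool n

subsets : (n : ℕ) → List (Subset n)
subsets zero    = [] ∷ []
subsets (suc n) = map (false ∷_) (subsets n) ++ map (true ∷_) (subsets n)

size : ∀ {n} → Subset n → ℕ
size []          = 0
size (false ∷ s) = size s
size (true ∷ s)  = suc (size s)

_∈ˢ_ : ∀ {n} → Fin n → Subset n → Bool
i ∈ˢ S = lookup S i

-- reach A S m u v = true iff there is a walk from u to v of length ≤ m,
-- all of whose vertices lie in S (u itself is assumed in S by callers).
reach : ∀ {n} → Adjacency n → Subset n → ℕ → Fin n → Fin n → Bool
reach {n} A S zero    u v = toℕ u ≡ᵇ toℕ v
reach {n} A S (suc m) u v =
  reach A S m u v ∨ any (λ w → (w ∈ˢ S) ∧ (reach A S m u w ∧ A w v)) (allFin n)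

-- S induces a connected subgraph: S is nonempty and any two vertices of S are
-- joined by a walk inside S (walks of length ≤ n suffice on n vertices).
connectedSet : ∀ {n} → Adjacency n → Subset n → Bool
connectedSet {n} A S =
  any (λ u → u ∈ˢ S) (allFin n) ∧
  all (λ u → not (u ∈ˢ S) ∨
        all (λ v → not (v ∈ˢ S) ∨ reach A S n u v) (allFin n)) (allFin n)

S : ∀ {n} → ℕ → Adjacency n → ℕ
S {n} k A = length (filter (λ X → T? (connectedSet A X ∧ (size X ≡ᵇ k))) (subsets n))

full : (n : ℕ) → Subset n
full zero    = []
full (suc n) = true ∷ full n

IsConnected : ∀ {n} → Graph n → Set
IsConnected {n} G = T (connectedSet (adj G) (full n))

edgeCount : ∀ {n} → Graph n → ℕ
edgeCount {n} G = length (filter (λ p → T? p)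
  (Data.List.concatMap (λ i → map (λ j → (Data.Nat._<ᵇ_ (toℕ i) (toℕ j)) ∧ adj G i j) (allFin n)) (allFin n)))

Unicyclic : ∀ {n} → Graph n → Set
Unicyclic {n} G = IsConnected G Data.Product.× (edgeCount G ≡ n)

cycleAdj : (n : ℕ) → Adjacency n
cycleAdj n i j =
  ((suc (toℕ i) ≡ᵇ toℕ j) ∨ (suc (toℕ j) ≡ᵇ toℕ i)) ∨
  (((toℕ i ≡ᵇ 0) ∧ (suc (toℕ j) ≡ᵇ n)) ∨ ((toℕ j ≡ᵇ 0) ∧ (suc (toℕ i) ≡ᵇ n)))

-- U_n on Fin n: c = 0, a = 1, b = 2; triangle c a b, and every vertex ≥ 3 is a
-- pendant leaf attached at c.
UAdj : (n : ℕ) → Adjacency n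
UAdj n i j =
  not (toℕ i ≡ᵇ toℕ j) ∧
  (((toℕ i ≡ᵇ 0) ∨ (toℕ j ≡ᵇ 0)) ∨
   (((toℕ i ≡ᵇ 1) ∧ (toℕ j ≡ᵇ 2)) ∨ ((toℕ i ≡ᵇ 2) ∧ (toℕ j ≡ᵇ 1))))

IsomorphicTo : ∀ {n} → Graph n → Adjacency n → Set
IsomorphicTo {n} G H =
  Σ (Permutation′ n) λ π → ∀ i j → adj G i j ≡ H (π ⟨$⟩ʳ i) (π ⟨$⟩ʳ j)

{-# OPTIONS --safe #-}
module Submission where

-- For k ≥ 3 the k-sets containing the centre are exactly the connected k-sets of Uₙ, so it suffices to inject
-- the connected k-sets of G into the k-sets containing a fixed vertex; which vertex is immaterial, by swapping.
-- If v is a leaf of G with support u, a connected k-set containing v contains u and is sent to itself, and the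
-- sets avoiding v are injected into the k-sets of G − v containing u by induction, as long as G − v is not
-- 2-regular. If it is, it is a cycle: a connected k-set containing u is sent to itself, and one avoiding u is an
-- interval of the path G − v − u, which is sent to its interior together with u and v. This image is
-- disconnected, so it is not hit twice.
-- The invariant "degree sum ≤ 2 · order" survives deleting a leaf, and forces 2-regularity once no vertex has
-- fewer than two neighbours; G itself is then a cycle, which is excluded.
-- For k = 2 the connected sets are the n edges.

open import Defs
open import Data.Nat using (ℕ; _≤_)
open import Relation.Nullary using (¬_)

open import Data.Bool using (Bool; true; false; T; _∧_; _∨_; not)
open import Data.Bool.Properties using (T?; T-≡; T-∧; T-∨; ¬-not)
import Data.Bool.Properties as Bool
open import Data.Bool.ListAction using (any)
open import Data.Fin using (Fin; zero; suc; toℕ; fromℕ<; _≟_)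
open import Data.Fin.Properties using (any?; fromℕ<-injective; toℕ<n; toℕ-injective; toℕ-fromℕ<; pigeonhole; injective⇒≤)
open import Data.List using (List; []; _∷_; _++_; length; filter; map; concatMap; allFin; tabulate; cartesianProduct)
open import Data.List.Properties using (length-++; filter-++; map-∘; map-++; length-tabulate)
open import Data.List.Membership.Propositional using (lose) renaming (_∈_ to _∈ₗ_)
open import Data.List.Membership.Propositional.Properties
  using (∈-∃++; ∈-++⁺ˡ; ∈-++⁺ʳ; ∈-++⁻; ∈-map⁺; ∈-map⁻; ∈-filter⁺; ∈-filter⁻; ∈-allFin; ∈-cartesianProduct⁺)
open import Data.List.Relation.Unary.All using () renaming (lookup to All-lookup)
open import Data.List.Relation.Unary.All.Properties using (all⁺; all⁻; tabulate⁺)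
open import Data.List.Relation.Unary.AllPairs using ([]; _∷_)
open import Data.List.Relation.Unary.Any using (here; there; satisfied)
open import Data.List.Relation.Unary.Any.Properties using (any⁺; any⁻)
open import Data.List.Relation.Unary.Unique.Propositional using (Unique)
import Data.List.Relation.Unary.Unique.Propositional.Properties as Unique
open import Data.Nat using (zero; suc; _+_; _<_; z≤n; s≤s; _≡ᵇ_; _<ᵇ_)
open import Data.Nat.Properties hiding (_≟_)
open import Data.Product using (∃; ∃-syntax; _×_; _,_; proj₁; proj₂; uncurry)
open import Data.Sum using (_⊎_; inj₁; inj₂; [_,_]′)
open import Data.Unit using (tt)
open import Data.Empty using (⊥; ⊥-elim)
open import Data.Fin.Permutation using (Permutation′; permutation)
open import Data.Fin.Subset using (_∈_; _⊆_) renaming (⊥ to ∅)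
open import Data.Fin.Subset.Properties using (_∈?_; ∉⊥; ⊆-antisym)
open import Data.Vec using ([]; _∷_; here; there; lookup; _[_]≔_)
open import Data.Vec.Properties using (lookup∘update; lookup∘update′; []=⇒lookup; lookup⇒[]=; []≔-updates; []≔-minimal)
open import Function using (_∘_; id; Equivalence)
open import Relation.Binary.Definitions using (Tri; tri<; tri≈; tri>)
open import Relation.Binary.PropositionalEquality as ≡ using (_≡_; _≢_; refl; cong; cong₂; subst; trans)
open import Relation.Nullary using (Dec; yes; no; contradiction)
open import Relation.Nullary.Decidable using (_×-dec_; ¬?; decidable-stable)
open import Relation.Unary using (Decidable)

open import Algebra.Properties.CommutativeMonoid.Sum +-0-commutativeMonoid
  using (sum; ∑-distrib-+; ∑-comm; sum-cong-≗)

private variable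
  n k : ℕ
  A B C : Set

-- Counting by injections

infix 4 _≼_

-- An injection from P into Q, as a relation because the image of x may depend on the proof of P x.
record _≼_ (P : A → Set) (Q : B → Set) : Set₁ where
  field
    rel       : A → B → Set
    total     : ∀ {x} → P x → ∃[ y ] Q y × rel x y
    injective : ∀ {x x′ y} → rel x y → rel x′ y → x ≡ x′

open _≼_

≼-⊆ : {P Q : A → Set} → (∀ {x} → P x → Q x) → P ≼ Q
≼-⊆ P⊆Q = record
  { rel       = _≡_
  ; total     = λ Px → _ , P⊆Q Px , refl
  ; injective = λ { refl refl → refl }
  }

≼-trans : {P : A → Set} {Q : B → Set} {R : C → Set} → P ≼ Q → Q ≼ R → P ≼ R
≼-trans {B = B} {Q = Q} f g = record
  { rel       = λ x z → ∃[ y ] rel f x y × rel g y z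
  ; total     = λ Px → let y , Qy , r = total f Px ; z , Rz , s = total g Qy in z , Rz , y , r , s
  ; injective = λ { (y , r , s) (y′ , r′ , s′) → inj r r′ (injective g s s′) }
  }
  where
  inj : ∀ {x x′ y y′} → rel f x y → rel f x′ y′ → y ≡ y′ → x ≡ x′
  inj r r′ refl = injective f r r′

-- Induction on `xs`: the image `y` of the head is cut out of `ys`. By injectivity no later element
-- can be related to that occurrence, so the tail still maps into what remains.
length-injective : {R : A → B → Set} → (∀ {x x′ y} → R x y → R x′ y → x ≡ x′) →
  ∀ {xs ys} → Unique xs → (∀ {x} → x ∈ₗ xs → ∃[ y ] y ∈ₗ ys × R x y) → length xs ≤ length ys
length-injective inj {[]} _ _ = z≤n
length-injective {R = R} inj {x ∷ xs} {ys} (x∉xs ∷ uniq) f with f (here refl)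
... | y , y∈ys , Rxy with ∈-∃++ y∈ys
... | as , bs , refl = begin
  suc (length xs)              ≤⟨ s≤s (length-injective inj uniq g) ⟩
  suc (length (as ++ bs))      ≡⟨ cong suc (length-++ as) ⟩
  suc (length as + length bs)  ≡⟨ +-suc (length as) (length bs) ⟨
  length as + suc (length bs)  ≡⟨ length-++ as ⟨
  length (as ++ y ∷ bs)        ∎
  where
  open ≤-Reasoning
  g : ∀ {x′} → x′ ∈ₗ xs → ∃[ y′ ] y′ ∈ₗ as ++ bs × R x′ y′
  g {x′} x′∈ with f (there x′∈)
  ... | y′ , y′∈ , r with ∈-++⁻ as y′∈
  ... | inj₁ ∈as = y′ , ∈-++⁺ˡ ∈as , r
  ... | inj₂ (here refl) = contradiction (inj Rxy r) (All-lookup x∉xs x′∈)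
  ... | inj₂ (there ∈bs) = y′ , ∈-++⁺ʳ as ∈bs , r

length-filter-≼ : {P : A → Set} {Q : B → Set} (P? : Decidable P) (Q? : Decidable Q) → P ≼ Q →
  ∀ {xs ys} → Unique xs → (∀ y → y ∈ₗ ys) → length (filter P? xs) ≤ length (filter Q? ys)
length-filter-≼ P? Q? f {xs} uniq complete = length-injective {R = rel f} (injective f) (Unique.filter⁺ P? uniq) λ x∈ →
  let y , Qy , r = total f (proj₂ (∈-filter⁻ P? {xs = xs} x∈)) in y , ∈-filter⁺ Q? (complete y) Qy , r

-- Subsets of Fin n

≡true-cong : {a b : Bool} → (a ≡ true → b ≡ true) → (b ≡ true → a ≡ true) → a ≡ b
≡true-cong {true}  f g = ≡.sym (f refl)
≡true-cong {false} {true}  f g = g refl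
≡true-cong {false} {false} f g = refl

∈-full : (x : Fin n) → x ∈ full n
∈-full zero    = here
∈-full (suc x) = there (∈-full x)

size-full : ∀ n → size (full n) ≡ n
size-full zero    = refl
size-full (suc n) = cong suc (size-full n)

∈-subsets : (X : Subset n) → X ∈ₗ subsets n
∈-subsets []          = here refl
∈-subsets (false ∷ X) = ∈-++⁺ˡ (∈-map⁺ _ (∈-subsets X))
∈-subsets (true ∷ X)  = ∈-++⁺ʳ _ (∈-map⁺ _ (∈-subsets X))

subsets-unique : ∀ n → Unique (subsets n)
subsets-unique zero    = Data.List.Relation.Unary.All.[] ∷ []
subsets-unique (suc n) = Unique.++⁺
  (Unique.map⁺ (λ { refl → refl }) (subsets-unique n))
  (Unique.map⁺ (λ { refl → refl }) (subsets-unique n))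
  λ { (∈f , ∈t) → case-disjoint (∈-map⁻ _ ∈f) (∈-map⁻ _ ∈t) }
  where
  case-disjoint : ∀ {X : Subset (suc n)} {xs ys} →
    ∃ (λ Y → Y ∈ₗ xs × X ≡ false ∷ Y) → ∃ (λ Y → Y ∈ₗ ys × X ≡ true ∷ Y) → ⊥
  case-disjoint (_ , _ , refl) (_ , _ , ())

infixl 6 _+ᵛ_ _-ᵛ_

_+ᵛ_ _-ᵛ_ : Subset n → Fin n → Subset n
X +ᵛ a = X [ a ]≔ true
X -ᵛ a = X [ a ]≔ false

module _ {X : Subset n} {a : Fin n} where

  ∈-+ᵛ : a ∈ X +ᵛ a
  ∈-+ᵛ = []≔-updates X a

  ⊆-+ᵛ : X ⊆ X +ᵛ a
  ⊆-+ᵛ {x} x∈X with x ≟ a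
  ... | yes refl = ∈-+ᵛ
  ... | no x≢a   = []≔-minimal X x a x≢a x∈X

  ∈-+ᵛ⁻ : ∀ {x} → x ∈ X +ᵛ a → x ≡ a ⊎ x ∈ X
  ∈-+ᵛ⁻ {x} x∈ with x ≟ a
  ... | yes x≡a = inj₁ x≡a
  ... | no x≢a  = inj₂ (lookup⇒[]= x X (trans (≡.sym (lookup∘update′ x≢a X true)) ([]=⇒lookup x∈)))

  ∈--ᵛ⁺ : ∀ {x} → x ∈ X → x ≢ a → x ∈ X -ᵛ a
  ∈--ᵛ⁺ {x} x∈X x≢a = []≔-minimal X x a x≢a x∈X

  ∉--ᵛ : ¬ a ∈ X -ᵛ a
  ∉--ᵛ a∈ with trans (≡.sym ([]=⇒lookup a∈)) (lookup∘update a X false)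
  ... | ()

  ∈--ᵛ⁻ : ∀ {x} → x ∈ X -ᵛ a → x ∈ X × x ≢ a
  ∈--ᵛ⁻ {x} x∈ with x ≟ a
  ... | yes refl = contradiction x∈ ∉--ᵛ
  ... | no x≢a   = lookup⇒[]= x X (trans (≡.sym (lookup∘update′ x≢a X false)) ([]=⇒lookup x∈)) , x≢a

size-+ᵛ : (X : Subset n) (a : Fin n) → ¬ a ∈ X → size (X +ᵛ a) ≡ suc (size X)
size-+ᵛ (false ∷ X) zero    _   = refl
size-+ᵛ (true  ∷ X) zero    a∉X = contradiction here a∉X
size-+ᵛ (false ∷ X) (suc a) a∉X = size-+ᵛ X a (a∉X ∘ there)
size-+ᵛ (true  ∷ X) (suc a) a∉X = cong suc (size-+ᵛ X a (a∉X ∘ there))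

size--ᵛ : (X : Subset n) (a : Fin n) → a ∈ X → suc (size (X -ᵛ a)) ≡ size X
size--ᵛ (true  ∷ X) zero    _   = refl
size--ᵛ (false ∷ X) (suc a) (there a∈X) = size--ᵛ X a a∈X
size--ᵛ (true  ∷ X) (suc a) (there a∈X) = cong suc (size--ᵛ X a a∈X)

size≤suc-size--ᵛ : (X : Subset n) (a : Fin n) → size X ≤ suc (size (X -ᵛ a))
size≤suc-size--ᵛ (false ∷ X) zero    = n≤1+n _
size≤suc-size--ᵛ (true  ∷ X) zero    = ≤-refl
size≤suc-size--ᵛ (false ∷ X) (suc a) = size≤suc-size--ᵛ X a
size≤suc-size--ᵛ (true  ∷ X) (suc a) = s≤s (size≤suc-size--ᵛ X a)

inhabited : (X : Subset n) → 1 ≤ size X → ∃[ x ] x ∈ X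
inhabited (true  ∷ X) _ = zero , here
inhabited (false ∷ X) h = let x , x∈X = inhabited X h in suc x , there x∈X

member-avoiding₁ : (X : Subset n) (a : Fin n) → 2 ≤ size X → ∃[ x ] x ∈ X × x ≢ a
member-avoiding₁ X a h =
  let x , x∈ = inhabited (X -ᵛ a) (≤-pred (≤-trans h (size≤suc-size--ᵛ X a))) in x , ∈--ᵛ⁻ x∈

member-avoiding₂ : (X : Subset n) (a b : Fin n) → 3 ≤ size X → ∃[ x ] x ∈ X × x ≢ a × x ≢ b
member-avoiding₂ X a b h =
  let x , x∈ , x≢b = member-avoiding₁ (X -ᵛ a) b (≤-pred (≤-trans h (size≤suc-size--ᵛ X a)))
      x∈X , x≢a    = ∈--ᵛ⁻ x∈
  in x , x∈X , x≢a , x≢b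

Pointed : ℕ → Fin n → Subset n → Subset n → Set
Pointed k c W X = c ∈ X × X ⊆ W × size X ≡ k

size-exchange : (X : Subset n) {a b : Fin n} → a ∈ X → ¬ b ∈ X → size (X -ᵛ a +ᵛ b) ≡ size X
size-exchange X {a} {b} a∈X b∉X =
  trans (size-+ᵛ (X -ᵛ a) b (b∉X ∘ proj₁ ∘ ∈--ᵛ⁻)) (size--ᵛ X a a∈X)

-- A set without `d` trades `c` for `d`; the others stay fixed. The image still contains `c` exactly
-- when nothing was traded, so `Y` reveals which case applies and the trade can be undone.
Pointed-≼ : {W : Subset n} {c d : Fin n} → d ∈ W → Pointed k c W ≼ Pointed k d W
Pointed-≼ {n} {k} {W} {c} {d} d∈W = record
  { rel = Rel ; total = tot ; injective = inj }
  where
  Rel : Subset n → Subset n → Set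
  Rel X Y = (c ∈ Y × X ≡ Y) ⊎ (¬ c ∈ Y × X ≡ Y -ᵛ d +ᵛ c)

  inj : ∀ {X X′ Y} → Rel X Y → Rel X′ Y → X ≡ X′
  inj (inj₁ (_   , refl)) (inj₁ (_   , refl)) = refl
  inj (inj₂ (_   , refl)) (inj₂ (_   , refl)) = refl
  inj (inj₁ (c∈Y , _))    (inj₂ (c∉Y , _))    = contradiction c∈Y c∉Y
  inj (inj₂ (c∉Y , _))    (inj₁ (c∈Y , _))    = contradiction c∈Y c∉Y

  tot : ∀ {X} → Pointed k c W X → ∃[ Y ] Pointed k d W Y × Rel X Y
  tot {X} (c∈X , X⊆W , |X|) with d ∈? X
  ... | yes d∈X = X , (d∈X , X⊆W , |X|) , inj₁ (c∈X , refl)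
  ... | no d∉X  = Y
    , (∈-+ᵛ , (λ {x} → [ (λ { refl → d∈W }) , X⊆W ∘ proj₁ ∘ ∈--ᵛ⁻ ]′ ∘ ∈-+ᵛ⁻ {x = x}) , trans (size-exchange X c∈X d∉X) |X|)
    , inj₂ ((λ c∈Y → [ (λ { refl → d∉X c∈X }) , ∉--ᵛ ]′ (∈-+ᵛ⁻ c∈Y)) , ⊆-antisym X⊆Z Z⊆X)
    where
    Y = X -ᵛ c +ᵛ d
    X⊆Z : X ⊆ Y -ᵛ d +ᵛ c
    X⊆Z {x} x∈X with x ≟ c
    ... | yes refl = ∈-+ᵛ
    ... | no x≢c   = ⊆-+ᵛ (∈--ᵛ⁺ (⊆-+ᵛ (∈--ᵛ⁺ x∈X x≢c)) λ { refl → d∉X x∈X })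
    Z⊆X : Y -ᵛ d +ᵛ c ⊆ X
    Z⊆X x∈ with ∈-+ᵛ⁻ x∈
    ... | inj₁ refl = c∈X
    ... | inj₂ x∈′ with ∈--ᵛ⁻ x∈′
    ... | x∈Y , x≢d = [ (λ x≡d → contradiction x≡d x≢d) , proj₁ ∘ ∈--ᵛ⁻ ]′ (∈-+ᵛ⁻ x∈Y)

-- Sums and degree sums

sum-mono-≤ : {f g : Fin n → ℕ} → (∀ i → f i ≤ g i) → sum f ≤ sum g
sum-mono-≤ {zero}  f≤g = z≤n
sum-mono-≤ {suc n} f≤g = +-mono-≤ (f≤g zero) (sum-mono-≤ (f≤g ∘ suc))

sum-mono-< : {f g : Fin n → ℕ} → (∀ i → f i ≤ g i) → ∀ {a} → f a < g a → sum f < sum g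
sum-mono-< {suc n} f≤g {zero}  fa<ga = +-mono-<-≤ fa<ga (sum-mono-≤ (f≤g ∘ suc))
sum-mono-< {suc n} f≤g {suc a} fa<ga = +-mono-≤-< (f≤g zero) (sum-mono-< (f≤g ∘ suc) fa<ga)

+-mono-<-< : ∀ {a b c d} → a < b → c < d → 2 + (a + c) ≤ b + d
+-mono-<-< {a} {b} {c} {d} a<b c<d = subst (_≤ b + d) (cong suc (+-suc a c)) (+-mono-≤ a<b c<d)

-- Meant for deleting a leaf, which lowers the degree both at the leaf and at its support.
sum-mono-<₂ : {f g : Fin n → ℕ} → (∀ i → f i ≤ g i) →
  ∀ {a b} → a ≢ b → f a < g a → f b < g b → 2 + sum f ≤ sum g
sum-mono-<₂ {suc n} f≤g {zero}  {zero}  a≢b _ _ = contradiction refl a≢b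
sum-mono-<₂ {suc n} f≤g {zero}  {suc b} _ fa<ga fb<gb = +-mono-<-< fa<ga (sum-mono-< (f≤g ∘ suc) fb<gb)
sum-mono-<₂ {suc n} f≤g {suc a} {zero}  _ fa<ga fb<gb = +-mono-<-< fb<gb (sum-mono-< (f≤g ∘ suc) fa<ga)
sum-mono-<₂ {suc n} {f} {g} f≤g {suc a} {suc b} a≢b fa<ga fb<gb =
  subst (_≤ sum g) (trans (+-suc (f zero) _) (cong suc (+-suc (f zero) _)))
    (+-mono-≤ (f≤g zero) (sum-mono-<₂ (f≤g ∘ suc) (a≢b ∘ cong suc) fa<ga fb<gb))

two≤sum : {f : Fin n → ℕ} {a b : Fin n} → a ≢ b → 1 ≤ f a → 1 ≤ f b → 2 ≤ sum f
two≤sum {f = f} a≢b fa fb = ≤-trans (m≤m+n 2 _) (sum-mono-<₂ {f = λ _ → 0} {f} (λ _ → z≤n) a≢b fa fb)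

-- Erasing the value at `a` lowers the sum strictly, and the values at `b` and `c` still contribute
-- two.
three≤sum : {f : Fin n → ℕ} {a b c : Fin n} → a ≢ b → a ≢ c → b ≢ c → 1 ≤ f a → 1 ≤ f b → 1 ≤ f c → 3 ≤ sum f
three≤sum {n} {f} {a} {b} {c} a≢b a≢c b≢c fa fb fc =
  ≤-trans (s≤s (two≤sum {f = f′} b≢c (f′-positive (a≢b ∘ ≡.sym) fb) (f′-positive (a≢c ∘ ≡.sym) fc)))
    (sum-mono-< f′≤f f′a<fa)
  where
  f′ : Fin n → ℕ
  f′ i with i ≟ a
  ... | yes _ = 0
  ... | no _  = f i
  f′≤f : ∀ i → f′ i ≤ f i
  f′≤f i with i ≟ a
  ... | yes _ = z≤n
  ... | no _  = ≤-refl
  f′-positive : ∀ {i} → i ≢ a → 1 ≤ f i → 1 ≤ f′ i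
  f′-positive {i} i≢a fi with i ≟ a
  ... | yes i≡a = contradiction i≡a i≢a
  ... | no _    = fi
  f′a<fa : f′ a < f a
  f′a<fa with a ≟ a
  ... | yes _  = fa
  ... | no a≢a = contradiction refl a≢a

𝟙 : Bool → ℕ
𝟙 true  = 1
𝟙 false = 0

𝟙-mono : ∀ {a b} → (a ≡ true → b ≡ true) → 𝟙 a ≤ 𝟙 b
𝟙-mono {false} _ = z≤n
𝟙-mono {true}  f rewrite f refl = ≤-refl

𝟙-< : ∀ {a b} → a ≢ true → b ≡ true → 𝟙 a < 𝟙 b
𝟙-< {false} _ refl = ≤-refl
𝟙-< {true}  a≢true _ = contradiction refl a≢true

𝟙-positive : ∀ {a} → a ≡ true → 1 ≤ 𝟙 a
𝟙-positive refl = ≤-refl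

size-sum : (X : Subset n) → size X ≡ sum (𝟙 ∘ lookup X)
size-sum []          = refl
size-sum (false ∷ X) = size-sum X
size-sum (true  ∷ X) = cong suc (size-sum X)

length-filter-T : ∀ {m} (f : A → Bool) (g : Fin m → A) →
  length (filter T? (map f (tabulate g))) ≡ sum (𝟙 ∘ f ∘ g)
length-filter-T {m = zero}  f g = refl
length-filter-T {m = suc m} f g with f (g zero)
... | true  = cong suc (length-filter-T f (g ∘ suc))
... | false = length-filter-T f (g ∘ suc)

length-filter-concatMap : ∀ {m} (h : A → List Bool) (g : Fin m → A) →
  length (filter T? (concatMap h (tabulate g))) ≡ sum λ i → length (filter T? (h (g i)))
length-filter-concatMap {m = zero}  h g = refl
length-filter-concatMap {m = suc m} h g = begin
  length (filter T? (h (g zero) ++ rest))                        ≡⟨ cong length (filter-++ T? (h (g zero)) rest) ⟩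
  length (filter T? (h (g zero)) ++ filter T? rest)              ≡⟨ length-++ (filter T? (h (g zero))) ⟩
  length (filter T? (h (g zero))) + length (filter T? rest)      ≡⟨ cong (length (filter T? (h (g zero))) +_) (length-filter-concatMap h (g ∘ suc)) ⟩
  sum (λ i → length (filter T? (h (g i))))                       ∎
  where
  open ≡.≡-Reasoning
  rest = concatMap h (tabulate (g ∘ suc))

∧-true⁻ : ∀ {a b} → a ∧ b ≡ true → a ≡ true × b ≡ true
∧-true⁻ {true} b≡true = refl , b≡true

∧-true⁺ : ∀ {a b} → a ≡ true → b ≡ true → a ∧ b ≡ true
∧-true⁺ refl refl = refl

<ᵇ-true : ∀ {a b} → a < b → (a <ᵇ b) ≡ true
<ᵇ-true a<b = Equivalence.to T-≡ (<⇒<ᵇ a<b)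

<ᵇ-false : ∀ {a b} → ¬ a < b → (a <ᵇ b) ≡ false
<ᵇ-false a≮b = ¬-not (a≮b ∘ <ᵇ⇒< _ _ ∘ Equivalence.from T-≡)

-- Degrees inside a vertex set

module _ {n : ℕ} (G : Graph n) where

  Adj : Fin n → Fin n → Set
  Adj x y = adj G x y ≡ true

  Adj-sym : ∀ {x y} → Adj x y → Adj y x
  Adj-sym {x} {y} xy = trans (Graph.sym G y x) xy

  Adj⇒≢ : ∀ {x y} → Adj x y → x ≢ y
  Adj⇒≢ {x} xy refl with trans (≡.sym xy) (irrfl G x)
  ... | ()

  -- Both ends are tested for membership, so vertices outside `W` have degree zero and sums over all
  -- of `Fin n` are sums over the induced subgraph.
  adjacentIn : Subset n → Fin n → Fin n → Bool
  adjacentIn W x y = lookup W x ∧ lookup W y ∧ adj G x y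

  module _ {W : Subset n} {x y : Fin n} where

    adjacentIn⁻ : adjacentIn W x y ≡ true → x ∈ W × y ∈ W × Adj x y
    adjacentIn⁻ h = let a , h′ = ∧-true⁻ h ; b , c = ∧-true⁻ h′ in lookup⇒[]= x W a , lookup⇒[]= y W b , c

    adjacentIn⁺ : x ∈ W → y ∈ W → Adj x y → adjacentIn W x y ≡ true
    adjacentIn⁺ x∈W y∈W xy = ∧-true⁺ ([]=⇒lookup x∈W) (∧-true⁺ ([]=⇒lookup y∈W) xy)

  degree : Subset n → Fin n → ℕ
  degree W x = sum (𝟙 ∘ adjacentIn W x)

  degreeSum : Subset n → ℕ
  degreeSum W = sum (degree W)

  edge : Fin n → Fin n → Bool
  edge x y = (toℕ x <ᵇ toℕ y) ∧ adj G x y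

  edgeCount-sum : edgeCount G ≡ sum λ x → sum λ y → 𝟙 (edge x y)
  edgeCount-sum = trans
    (length-filter-concatMap (λ x → map (edge x) (allFin n)) id)
    (sum-cong-≗ λ x → length-filter-T (edge x) id)

  adjacentIn-full : ∀ x y → 𝟙 (adjacentIn (full n) x y) ≡ 𝟙 (edge x y) + 𝟙 (edge y x)
  adjacentIn-full x y rewrite []=⇒lookup (∈-full x) | []=⇒lookup (∈-full y) | Graph.sym G y x
    with adj G x y in xy
  ... | false rewrite Bool.∧-zeroʳ (toℕ x <ᵇ toℕ y) | Bool.∧-zeroʳ (toℕ y <ᵇ toℕ x) = refl
  ... | true  rewrite Bool.∧-identityʳ (toℕ x <ᵇ toℕ y) | Bool.∧-identityʳ (toℕ y <ᵇ toℕ x)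
    with <-cmp (toℕ x) (toℕ y)
  ... | tri< x<y _ y≮x rewrite <ᵇ-true x<y | <ᵇ-false y≮x = refl
  ... | tri≈ _ x≡y _ = contradiction (toℕ-injective x≡y) (Adj⇒≢ xy)
  ... | tri> x≮y _ y<x rewrite <ᵇ-true y<x | <ᵇ-false x≮y = refl

  -- The handshake lemma. An adjacent ordered pair is increasing or decreasing, and exchanging the
  -- order of summation identifies the two counts.
  degreeSum-full : degreeSum (full n) ≡ edgeCount G + edgeCount G
  degreeSum-full = begin
    sum (λ x → sum (λ y → 𝟙 (adjacentIn (full n) x y)))
      ≡⟨ sum-cong-≗ (λ x → trans (sum-cong-≗ (adjacentIn-full x)) (∑-distrib-+ (𝟙 ∘ edge x) (λ y → 𝟙 (edge y x)))) ⟩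
    sum (λ x → sum (λ y → 𝟙 (edge x y)) + sum (λ y → 𝟙 (edge y x)))
      ≡⟨ ∑-distrib-+ (λ x → sum (λ y → 𝟙 (edge x y))) (λ x → sum (λ y → 𝟙 (edge y x))) ⟩
    sum (λ x → sum (λ y → 𝟙 (edge x y))) + sum (λ x → sum (λ y → 𝟙 (edge y x)))
      ≡⟨ cong (sum (λ x → sum (λ y → 𝟙 (edge x y))) +_) (∑-comm (λ x y → 𝟙 (edge y x))) ⟩
    sum (λ x → sum (λ y → 𝟙 (edge x y))) + sum (λ x → sum (λ y → 𝟙 (edge x y)))
      ≡⟨ cong₂ _+_ edgeCount-sum edgeCount-sum ⟨
    edgeCount G + edgeCount G ∎
    where open ≡.≡-Reasoning

  -- The ordered pairs `(v , u)` and `(u , v)` are lost, in the rows of two different vertices.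
  degreeSum--ᵛ : ∀ {W v u} → v ∈ W → u ∈ W → Adj v u → 2 + degreeSum (W -ᵛ v) ≤ degreeSum W
  degreeSum--ᵛ {W} {v} {u} v∈W u∈W vu =
    sum-mono-<₂ (λ x → sum-mono-≤ (mono x)) (Adj⇒≢ vu)
      (sum-mono-< (mono v) (𝟙-< (∉--ᵛ ∘ proj₁ ∘ adjacentIn⁻ {W -ᵛ v}) (adjacentIn⁺ v∈W u∈W vu)))
      (sum-mono-< (mono u) (𝟙-< (∉--ᵛ ∘ proj₁ ∘ proj₂ ∘ adjacentIn⁻ {W -ᵛ v} {u} {v}) (adjacentIn⁺ u∈W v∈W (Adj-sym vu))))
    where
    mono : ∀ x y → 𝟙 (adjacentIn (W -ᵛ v) x y) ≤ 𝟙 (adjacentIn W x y)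
    mono x y = 𝟙-mono λ h → let x∈ , y∈ , xy = adjacentIn⁻ {W -ᵛ v} h in
      adjacentIn⁺ (proj₁ (∈--ᵛ⁻ x∈)) (proj₁ (∈--ᵛ⁻ y∈)) xy

  NeighbourIn : Subset n → Fin n → Fin n → Set
  NeighbourIn W x y = y ∈ W × Adj x y

  -- This means at least two. Its failure at a vertex that has a neighbour makes that vertex a leaf.
  TwoNeighbours : Subset n → Fin n → Set
  TwoNeighbours W x = ∃[ a ] ∃[ b ] (a ≢ b × NeighbourIn W x a × NeighbourIn W x b)

  NeighbourIn? : ∀ W x y → Dec (NeighbourIn W x y)
  NeighbourIn? W x y = (y ∈? W) ×-dec (adj G x y Bool.≟ true)

  TwoNeighbours? : ∀ W x → Dec (TwoNeighbours W x)
  TwoNeighbours? W x = any? λ a → any? λ b → ¬? (a ≟ b) ×-dec (NeighbourIn? W x a ×-dec NeighbourIn? W x b)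

  -- Every degree in `W` is at least two while the degree sum is at most twice the order, so one
  -- vertex of degree three would already exceed the bound. The comparison is pointwise with twice
  -- the indicator of `W`.
  atMostTwo : ∀ {W} → (∀ {x} → x ∈ W → TwoNeighbours W x) → degreeSum W ≤ size W + size W →
    ∀ {x a b c} → x ∈ W → NeighbourIn W x a → NeighbourIn W x b → NeighbourIn W x c →
    a ≢ b → a ≢ c → b ≢ c → ⊥
  atMostTwo {W} two D≤ {x} {a} {b} {c} x∈W (a∈ , xa) (b∈ , xb) (c∈ , xc) a≢b a≢c b≢c =
    <-irrefl refl (begin-strict
      sum (λ i → 𝟙 (lookup W i) + 𝟙 (lookup W i))  <⟨ sum-mono-< 2≤degree {x} 3≤degree ⟩
      degreeSum W                                  ≤⟨ D≤ ⟩
      size W + size W                              ≡⟨ cong₂ _+_ (size-sum W) (size-sum W) ⟩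
      sum (𝟙 ∘ lookup W) + sum (𝟙 ∘ lookup W)      ≡⟨ ∑-distrib-+ (𝟙 ∘ lookup W) (𝟙 ∘ lookup W) ⟨
      sum (λ i → 𝟙 (lookup W i) + 𝟙 (lookup W i))  ∎)
    where
    open ≤-Reasoning
    positive : ∀ {x y} → x ∈ W → NeighbourIn W x y → 1 ≤ 𝟙 (adjacentIn W x y)
    positive x∈ (y∈ , xy) = 𝟙-positive (adjacentIn⁺ x∈ y∈ xy)
    2≤degree : ∀ i → 𝟙 (lookup W i) + 𝟙 (lookup W i) ≤ degree W i
    2≤degree i with lookup W i in i∈
    ... | false = z≤n
    ... | true with i∈W ← lookup⇒[]= i W i∈ with two i∈W
    ... | a , b , a≢b , ia , ib = two≤sum a≢b (positive′ ia) (positive′ ib)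
      where
      -- Matching on `lookup W i` has already reduced away the first conjunct of `adjacentIn`.
      positive′ : ∀ {y} → NeighbourIn W i y → 1 ≤ 𝟙 (lookup W y ∧ adj G i y)
      positive′ (y∈ , iy) = 𝟙-positive (∧-true⁺ ([]=⇒lookup y∈) iy)
    3≤degree : 𝟙 (lookup W x) + 𝟙 (lookup W x) < degree W x
    3≤degree = ≤-trans (s≤s (≤-reflexive (cong (λ t → 𝟙 t + 𝟙 t) ([]=⇒lookup x∈W))))
      (three≤sum a≢b a≢c b≢c (positive x∈W (a∈ , xa)) (positive x∈W (b∈ , xb)) (positive x∈W (c∈ , xc)))

-- Connected 2-regular vertex sets are cycles

least : {P : ℕ → Set} → Decidable P → ∀ {m} → P m → ∃[ l ] P l × (∀ {i} → i < l → ¬ P i)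
least {P} P? {zero}  P0 = 0 , P0 , λ ()
least {P} P? {suc m} Pm with P? 0
... | yes P0 = 0 , P0 , λ ()
... | no ¬P0 with least (P? ∘ suc) {m} Pm
... | l , Pl , below = suc l , Pl , λ { {zero} _ → ¬P0 ; {suc i} (s≤s i<l) → below i<l }

greatest : {P : ℕ → Set} → Decidable P → ∀ {m i} → i < m → P i →
  ∃[ l ] l < m × P l × (∀ {j} → l < j → j < m → ¬ P j)
greatest P? {suc m} {i} i<1+m Pi with P? m
... | yes Pm = m , ≤-refl , Pm , λ m<j j<1+m → contradiction m<j (≤⇒≯ (≤-pred j<1+m))
... | no ¬Pm with greatest P? (≤∧≢⇒< (≤-pred i<1+m) λ { refl → ¬Pm Pi }) Pi
... | l , l<m , Pl , above = l , m≤n⇒m≤1+n l<m , Pl , above′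
  where
  above′ : ∀ {j} → l < j → j < suc m → _
  above′ {j} l<j j<1+m with j Data.Nat.≟ m
  ... | yes refl = ¬Pm
  ... | no j≢m   = above l<j (≤∧≢⇒< (≤-pred j<1+m) j≢m)

T-not-∨⁻ : ∀ {a b} → T (not a ∨ b) → a ≡ true → T b
T-not-∨⁻ t refl = t

module _ {n : ℕ} (G : Graph n) where

  -- Connectedness as an induction principle: a property that spreads along edges inside `X` spreads
  -- to all of `X`. Each use then only has to choose the property `C`, and no walks are handled.
  Connected : Subset n → Set₁
  Connected X = (C : Fin n → Set) → (∀ {x y} → x ∈ X → y ∈ X → Adj G x y → C x → C y) →
    ∀ {a b} → a ∈ X → b ∈ X → C a → C b

  connectedSet-sound : ∀ {X} → T (connectedSet (adj G) X) → Connected X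
  connectedSet-sound {X} conn C closed {a} {b} a∈X b∈X Ca = walk n b∈X
    (T-not-∨⁻ (All-lookup (all⁺ _ (allFin n)
      (T-not-∨⁻ (All-lookup (all⁺ _ (allFin n) (proj₂ (Equivalence.to (T-∧ {any (_∈ˢ X) (allFin n)}) conn))) (∈-allFin a)) ([]=⇒lookup a∈X)))
      (∈-allFin b)) ([]=⇒lookup b∈X))
    where
    walk : ∀ m {b} → b ∈ X → T (reach (adj G) X m a b) → C b
    walk zero {b} b∈X t = subst C (toℕ-injective (≡ᵇ⇒≡ (toℕ a) (toℕ b) t)) Ca
    walk (suc m) {b} b∈X t with Equivalence.to (T-∨ {reach (adj G) X m a b}) t
    ... | inj₁ t′ = walk m b∈X t′
    ... | inj₂ t′ with satisfied (any⁻ _ (allFin n) t′)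
    ... | w , t″ with Equivalence.to (T-∧ {lookup X w}) t″
    ... | w∈ , t‴ with Equivalence.to (T-∧ {reach (adj G) X m a w}) t‴
    ... | aw , wb = closed w∈X b∈X (Equivalence.to T-≡ wb) (walk m w∈X aw)
      where w∈X = lookup⇒[]= w X (Equivalence.to T-≡ w∈)

  -- The cycle is given as an unending walk `p`, so `p (suc (suc i))` always makes sense. Only index
  -- 0 has no predecessor on the walk; there the second neighbour is the vertex at index `len` minus
  -- one.
  record CycleIn (W : Subset n) (u : Fin n) : Set where
    field
      len      : ℕ
      p        : ℕ → Fin n
      3≤len    : 3 ≤ len
      p-zero   : p 0 ≡ u
      p-len    : p len ≡ p 0
      p∈W      : ∀ i → p i ∈ W
      p-adj    : ∀ i → Adj G (p i) (p (suc i))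
      p-inj    : ∀ {i j} → i < len → j < len → p i ≡ p j → i ≡ j
      nbr-zero : ∀ {y} → NeighbourIn G W (p 0) y → y ≡ p 1 ⊎ ∃[ i ] suc i ≡ len × y ≡ p i
      nbr-suc  : ∀ {i y} → NeighbourIn G W (p (suc i)) y → y ≡ p i ⊎ y ≡ p (suc (suc i))
      cover    : ∀ {x} → x ∈ W → ∃[ i ] i < len × x ≡ p i

  module _ {W : Subset n} (conn : Connected W) (two : ∀ {x} → x ∈ W → TwoNeighbours G W x)
    (D≤ : degreeSum G W ≤ size W + size W) {u : Fin n} (u∈W : u ∈ W) where

    private
      record Dart : Set where
        constructor dart
        field
          source target : Fin n
          source∈W : source ∈ W
          target∈W : target ∈ W
          arc : Adj G source target
      open Dart

      oneOf : ∀ {x a b y} → x ∈ W → NeighbourIn G W x a → NeighbourIn G W x b → a ≢ b →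
        NeighbourIn G W x y → y ≡ a ⊎ y ≡ b
      oneOf {x} {a} {b} {y} x∈W xa xb a≢b xy with y ≟ a | y ≟ b
      ... | yes y≡a | _       = inj₁ y≡a
      ... | no _    | yes y≡b = inj₂ y≡b
      ... | no y≢a  | no y≢b  = ⊥-elim (atMostTwo G two D≤ x∈W xy xa xb y≢a y≢b a≢b)

      another : ∀ {x} y → x ∈ W → ∃[ z ] NeighbourIn G W x z × z ≢ y
      another y x∈W with two x∈W
      ... | a , b , a≢b , xa , xb with a ≟ y
      ... | no a≢y   = a , xa , a≢y
      ... | yes refl = b , xb , a≢b ∘ ≡.sym

      -- The walk leaves each vertex by a neighbour other than the one it came from, so it never
      -- turns back; `q-skip` records this.
      next : Dart → Dart
      next (dart x y x∈ y∈ xy) = let z , (z∈ , yz) , _ = another x y∈ in dart y z y∈ z∈ yz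

      darts : ℕ → Dart
      -- The vertex to be avoided is a dummy here, since no neighbour of `u` equals `u`.
      darts zero    = let z , (z∈ , uz) , _ = another u u∈W in dart u z u∈W z∈ uz
      darts (suc i) = next (darts i)

      q : ℕ → Fin n
      q i = source (darts i)

      q∈W : ∀ i → q i ∈ W
      q∈W i = source∈W (darts i)

      q-adj : ∀ i → Adj G (q i) (q (suc i))
      q-adj i = arc (darts i)

      q-skip : ∀ i → q i ≢ q (suc (suc i))
      q-skip i = proj₂ (proj₂ (another (source (darts i)) (target∈W (darts i)))) ∘ ≡.sym

      forward : ∀ i → NeighbourIn G W (q i) (q (suc i))
      forward i = q∈W (suc i) , q-adj i

      backward : ∀ i → NeighbourIn G W (q (suc i)) (q i)
      backward i = q∈W i , Adj-sym G (q-adj i)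

      Repeats : ℕ → Set
      Repeats j = ∃[ i ] i < j × q i ≡ q j

      repeats : ∃ Repeats
      repeats with pigeonhole (n<1+n n) (q ∘ toℕ)
      ... | i , j , i<j , qi≡qj = toℕ j , toℕ i , i<j , qi≡qj

      -- The index of the first revisited vertex becomes the length of the cycle. Its minimality is
      -- what makes `q` injective below it.
      firstRepeat : ∃[ l ] Repeats l × (∀ {i} → i < l → ¬ Repeats i)
      firstRepeat = least (λ j → anyUpTo? (λ i → q i ≟ q j) j) (proj₂ repeats)

      l : ℕ
      l = proj₁ firstRepeat

      q-inj : ∀ {i j} → i < l → j < l → q i ≡ q j → i ≡ j
      q-inj {i} {j} i<l j<l eq with <-cmp i j
      ... | tri< i<j _ _ = contradiction (i , i<j , eq) (proj₂ (proj₂ firstRepeat) j<l)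
      ... | tri≈ _ i≡j _ = i≡j
      ... | tri> _ _ j<i = contradiction (j , j<i , ≡.sym eq) (proj₂ (proj₂ firstRepeat) i<l)

      nbr : ∀ {i y} → NeighbourIn G W (q (suc i)) y → y ≡ q i ⊎ y ≡ q (suc (suc i))
      nbr {i} = oneOf (q∈W (suc i)) (backward i) (forward (suc i)) (q-skip i)

      -- If the walk first closed up at a vertex other than its start, that vertex would have a third neighbour.
      closes-at-start : ∀ {l} → (∀ {i j} → i < l → j < l → q i ≡ q j → i ≡ j) → Repeats l → q 0 ≡ q l
      closes-at-start {l} inj (zero , _ , eq) = eq
      closes-at-start {suc l} inj (suc i , s≤s i<l , eq)
        with nbr {i} (subst (λ x → NeighbourIn G W x (q l)) (≡.sym eq) (backward l))
      ... | inj₁ ql≡qi = contradiction (inj (m<n⇒m<1+n i<l) ≤-refl (≡.sym ql≡qi)) (<⇒≢ i<l)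
      ... | inj₂ ql≡q2+i with suc (suc i) Data.Nat.≤? l
      -- Injectivity forces `l` to be `i` plus two, so the walk would have turned back at its last
      -- step.
      ... | yes 2+i≤l with inj ≤-refl (s≤s 2+i≤l) ql≡q2+i
      ... | refl = contradiction eq (q-skip (suc i))
      -- Here `l` is `suc i`, so the repeated vertex would be adjacent to itself.
      closes-at-start {suc l} inj (suc i , s≤s i<l , eq) | inj₂ _ | no 2+i≰l with ≤-antisym i<l (≤-pred (≰⇒> 2+i≰l))
      ... | refl = contradiction eq (Adj⇒≢ G (q-adj (suc i)))

      q0≡ql : q 0 ≡ q l
      q0≡ql = closes-at-start q-inj (proj₁ (proj₂ firstRepeat))

      -- Length one would be a loop and length two a walk that turns back.
      cycle : ∀ {l} → 0 < l → (∀ {i j} → i < l → j < l → q i ≡ q j → i ≡ j) → q 0 ≡ q l → CycleIn W u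
      cycle {suc zero}          _ inj q0≡ql = contradiction q0≡ql (Adj⇒≢ G (q-adj 0))
      cycle {suc (suc zero)}    _ inj q0≡ql = contradiction q0≡ql (q-skip 0)
      cycle {suc l@(suc (suc _))} _ inj q0≡ql = record
        { len = suc l ; p = q ; 3≤len = s≤s (s≤s (s≤s z≤n)) ; p-zero = refl ; p-len = ≡.sym q0≡ql
        ; p∈W = q∈W ; p-adj = q-adj ; p-inj = inj
        ; nbr-zero = nbr₀
        ; nbr-suc = λ {i} → nbr {i}
        -- All neighbours of a visited vertex are visited, so connectedness of `W` makes the walk
        -- visit everything.
        ; cover = λ x∈W → conn (λ x → ∃[ i ] i < suc l × x ≡ q i) closed u∈W x∈W (0 , s≤s z≤n , refl)
        }
        where
        nbr₀ : ∀ {y} → NeighbourIn G W (q 0) y → y ≡ q 1 ⊎ ∃[ i ] suc i ≡ suc l × y ≡ q i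
        nbr₀ 0y with oneOf (q∈W 0) (forward 0) (subst (λ x → NeighbourIn G W x (q l)) (≡.sym q0≡ql) (backward l))
          (λ q1≡ql → contradiction (inj (s≤s (s≤s z≤n)) ≤-refl q1≡ql) λ ()) 0y
        ... | inj₁ y≡q1 = inj₁ y≡q1
        ... | inj₂ y≡ql = inj₂ (l , refl , y≡ql)
        closed : ∀ {x y} → x ∈ W → y ∈ W → Adj G x y → ∃[ i ] (i < suc l × x ≡ q i) → ∃[ i ] (i < suc l × y ≡ q i)
        closed _ y∈W xy (zero , _ , refl) with nbr₀ (y∈W , xy)
        ... | inj₁ y≡q1 = 1 , s≤s (s≤s z≤n) , y≡q1
        ... | inj₂ (i , refl , y≡qi) = i , ≤-refl , y≡qi
        closed _ y∈W xy (suc i , i<l , refl) with nbr {i} (y∈W , xy)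
        ... | inj₁ y≡qi = i , <-trans (n<1+n i) i<l , y≡qi
        ... | inj₂ y≡q2+i with suc (suc i) Data.Nat.<? suc l
        ... | yes 2+i<1+l = suc (suc i) , 2+i<1+l , y≡q2+i
        -- The next index is exactly the length, where the walk is back at `q 0`.
        ... | no 2+i≮1+l = 0 , s≤s z≤n , trans y≡q2+i (trans (cong q (≤-antisym i<l (≮⇒≥ 2+i≮1+l))) (≡.sym q0≡ql))

    cycleIn : CycleIn W u
    cycleIn = cycle (≤-trans (s≤s z≤n) (proj₁ (proj₂ (proj₁ (proj₂ firstRepeat))))) q-inj q0≡ql

-- A cycle through all vertices is isomorphic to the standard cycle

∨-true⁻ : ∀ a {b} → a ∨ b ≡ true → a ≡ true ⊎ b ≡ true
∨-true⁻ true  _      = inj₁ refl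
∨-true⁻ false b≡true = inj₂ b≡true

∨-true⁺ʳ : ∀ a {b} → b ≡ true → a ∨ b ≡ true
∨-true⁺ʳ true  _      = refl
∨-true⁺ʳ false b≡true = b≡true

∨-true⁺ˡ : ∀ {a b} → a ≡ true → a ∨ b ≡ true
∨-true⁺ˡ refl = refl

≡ᵇ-true⁻ : ∀ m n → (m ≡ᵇ n) ≡ true → m ≡ n
≡ᵇ-true⁻ m n = ≡ᵇ⇒≡ m n ∘ Equivalence.from T-≡

≡ᵇ-true⁺ : ∀ m n → m ≡ n → (m ≡ᵇ n) ≡ true
≡ᵇ-true⁺ m n = Equivalence.to T-≡ ∘ ≡⇒≡ᵇ m n

module _ {n : ℕ} (G : Graph n) {u : Fin n} (cyc : CycleIn G (full n) u) where

  private
    open CycleIn cyc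

    index : Fin n → ℕ
    index x = proj₁ (cover (∈-full x))

    index<len : ∀ x → index x < len
    index<len x = proj₁ (proj₂ (cover (∈-full x)))

    p-index : ∀ x → x ≡ p (index x)
    p-index x = proj₂ (proj₂ (cover (∈-full x)))

    -- `p` is injective below `len`, and `index` is injective because `p` recovers the vertex from
    -- it.
    len≡n : len ≡ n
    len≡n = ≤-antisym
      (injective⇒≤ {f = p ∘ toℕ {len}} λ {i} {j} eq → toℕ-injective (p-inj (toℕ<n i) (toℕ<n j) eq))
      (injective⇒≤ {f = λ x → fromℕ< (index<len x)} λ {x} {y} eq → begin
        x            ≡⟨ p-index x ⟩
        p (index x)  ≡⟨ cong p (fromℕ<-injective _ _ (index<len x) (index<len y) eq) ⟩
        p (index y)  ≡⟨ p-index y ⟨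
        y            ∎)
      where open ≡.≡-Reasoning

    index<n : ∀ x → index x < n
    index<n x = subst (index x <_) len≡n (index<len x)

    labelling : Permutation′ n
    labelling = permutation (λ x → fromℕ< (index<n x)) (p ∘ toℕ)
      (λ i → toℕ-injective (trans (toℕ-fromℕ< (index<n (p (toℕ i))))
        (p-inj (index<len _) (subst (toℕ i <_) (≡.sym len≡n) (toℕ<n i)) (≡.sym (p-index (p (toℕ i)))))))
      (λ x → trans (cong p (toℕ-fromℕ< (index<n x))) (≡.sym (p-index x)))

    -- `cycleAdj n` on bare indices, so that it can be compared with `p` before passing to `Fin n`.
    cyclic : ℕ → ℕ → Bool
    cyclic i j = ((suc i ≡ᵇ j) ∨ (suc j ≡ᵇ i)) ∨ (((i ≡ᵇ 0) ∧ (suc j ≡ᵇ n)) ∨ ((j ≡ᵇ 0) ∧ (suc i ≡ᵇ n)))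

    0<len : 0 < len
    0<len = ≤-trans (s≤s z≤n) 3≤len

    adj⇒cyclic : ∀ i j → i < len → j < len → Adj G (p i) (p j) → cyclic i j ≡ true
    adj⇒cyclic zero j i<len j<len ij with nbr-zero (∈-full (p j) , ij)
    ... | inj₁ pj≡p1 = ∨-true⁺ˡ (∨-true⁺ˡ (≡ᵇ-true⁺ 1 j (≡.sym (p-inj j<len (≤-trans (s≤s (s≤s z≤n)) 3≤len) pj≡p1))))
    ... | inj₂ (l , 1+l≡len , pj≡pl) = ∨-true⁺ʳ ((1 ≡ᵇ j) ∨ false) (∨-true⁺ˡ (≡ᵇ-true⁺ (suc j) n
      (trans (cong suc (p-inj j<len (≤-reflexive 1+l≡len) pj≡pl)) (trans 1+l≡len len≡n))))
    adj⇒cyclic (suc i) j i<len j<len ij with nbr-suc (∈-full (p j) , ij)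
    ... | inj₁ pj≡pi = ∨-true⁺ˡ (∨-true⁺ʳ (suc (suc i) ≡ᵇ j)
      (≡ᵇ-true⁺ j i (p-inj j<len (<-trans (n<1+n i) i<len) pj≡pi)))
    ... | inj₂ pj≡p2+i with m≤n⇒m<n∨m≡n i<len
    ... | inj₁ 2+i<len = ∨-true⁺ˡ (∨-true⁺ˡ (≡ᵇ-true⁺ (suc (suc i)) j (≡.sym (p-inj j<len 2+i<len pj≡p2+i))))
    -- The successor of the last index wraps around to index 0.
    ... | inj₂ 2+i≡len = ∨-true⁺ʳ ((suc (suc i) ≡ᵇ j) ∨ (suc j ≡ᵇ suc i)) (∧-true⁺
      (≡ᵇ-true⁺ j 0 (p-inj j<len 0<len (trans pj≡p2+i (trans (cong p 2+i≡len) p-len))))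
      (≡ᵇ-true⁺ (suc (suc i)) n (trans 2+i≡len len≡n)))

    wrap : ∀ {i j} → i ≡ 0 → suc j ≡ n → Adj G (p j) (p i)
    wrap {j = j} refl 1+j≡n = subst (Adj G (p j)) (trans (cong p (trans 1+j≡n (≡.sym len≡n))) p-len) (p-adj j)

    cyclic⇒adj : ∀ i j → cyclic i j ≡ true → Adj G (p i) (p j)
    cyclic⇒adj i j h with ∨-true⁻ ((suc i ≡ᵇ j) ∨ (suc j ≡ᵇ i)) h
    ... | inj₁ h′ with ∨-true⁻ (suc i ≡ᵇ j) h′
    ...   | inj₁ e with ≡ᵇ-true⁻ (suc i) j e
    ...     | refl = p-adj i
    cyclic⇒adj i j h | inj₁ h′ | inj₂ e with ≡ᵇ-true⁻ (suc j) i e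
    ...     | refl = Adj-sym G (p-adj j)
    cyclic⇒adj i j h | inj₂ h′ with ∨-true⁻ ((i ≡ᵇ 0) ∧ (suc j ≡ᵇ n)) h′
    ... | inj₁ e = let e₁ , e₂ = ∧-true⁻ e in Adj-sym G (wrap (≡ᵇ-true⁻ i 0 e₁) (≡ᵇ-true⁻ (suc j) n e₂))
    ... | inj₂ e = let e₁ , e₂ = ∧-true⁻ e in wrap (≡ᵇ-true⁻ j 0 e₁) (≡ᵇ-true⁻ (suc i) n e₂)

    adj≡cyclic : ∀ x y → adj G x y ≡ cyclic (index x) (index y)
    adj≡cyclic x y = trans (cong₂ (adj G) (p-index x) (p-index y))
      (≡true-cong (adj⇒cyclic (index x) (index y) (index<len x) (index<len y)) (cyclic⇒adj (index x) (index y)))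

  isomorphicToCycle : IsomorphicTo G (cycleAdj n)
  isomorphicToCycle = labelling , λ x y → trans (adj≡cyclic x y)
    (≡.sym (cong₂ cyclic (toℕ-fromℕ< (index<n x)) (toℕ-fromℕ< (index<n y))))

module _ {n : ℕ} (G : Graph n) where

  -- Deleting a leaf

  -- Connectedness of `X` involves only edges inside `X`, so deleting a vertex is recorded by
  -- shrinking `W` while the graph stays the same.
  ConnectedIn : ℕ → Subset n → Subset n → Set
  ConnectedIn k W X = T (connectedSet (adj G) X) × X ⊆ W × size X ≡ k

  module Leaf {W : Subset n} {v u : Fin n} (v∈W : v ∈ W) (u∈W : u ∈ W) (vu : Adj G v u)
    (leaf : ∀ {y} → NeighbourIn G W v y → y ≡ u) where

    u≢v : u ≢ v
    u≢v = Adj⇒≢ G (Adj-sym G vu)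

    -- A property `C` on the smaller set is extended to `v` by giving `v` the value of `C` at its
    -- only neighbour `u`.
    Connected--ᵛ : Connected G W → Connected G (W -ᵛ v)
    Connected--ᵛ conn C closed {a} {b} a∈ b∈ Ca =
      [ (λ { (b≡v , _) → contradiction b≡v (proj₂ (∈--ᵛ⁻ b∈)) }) , proj₂ ]′
        (conn C′ closed′ (proj₁ (∈--ᵛ⁻ a∈)) (proj₁ (∈--ᵛ⁻ b∈)) (inj₂ (proj₂ (∈--ᵛ⁻ a∈) , Ca)))
      where
      C′ : Fin n → Set
      C′ x = (x ≡ v × C u) ⊎ (x ≢ v × C x)
      closed′ : ∀ {x y} → x ∈ W → y ∈ W → Adj G x y → C′ x → C′ y
      closed′ {x} {y} x∈W y∈W xy C′x with y ≟ v | C′x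
      ... | yes refl | inj₁ (refl , _)  = contradiction refl (Adj⇒≢ G xy)
      ... | yes refl | inj₂ (x≢v , Cx) with leaf (x∈W , Adj-sym G xy)
      ... | refl = inj₁ (refl , Cx)
      closed′ x∈W y∈W xy C′x | no y≢v | inj₁ (refl , Cu) with leaf (y∈W , xy)
      ... | refl = inj₂ (y≢v , Cu)
      closed′ x∈W y∈W xy C′x | no y≢v | inj₂ (x≢v , Cx) =
        inj₂ (y≢v , closed (∈--ᵛ⁺ x∈W x≢v) (∈--ᵛ⁺ y∈W y≢v) xy Cx)

    -- Without `u`, the vertex `v` has no neighbour in `X`, so the property of being `v` could not
    -- reach a second member.
    leaf⇒support : ∀ {X} → Connected G X → X ⊆ W → 2 ≤ size X → v ∈ X → u ∈ X
    leaf⇒support {X} conn X⊆W 2≤ v∈X with u ∈? X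
    ... | yes u∈X = u∈X
    ... | no u∉X = let x , x∈X , x≢v = member-avoiding₁ X v 2≤ in
      contradiction (conn (_≡ v) (λ { _ y∈X vy refl → contradiction (subst (_∈ X) (leaf (X⊆W y∈X , vy)) y∈X) u∉X }) v∈X x∈X refl) x≢v

    avoid : ∀ {X} → X ⊆ W → ¬ v ∈ X → X ⊆ W -ᵛ v
    avoid X⊆W v∉X x∈X = ∈--ᵛ⁺ (X⊆W x∈X) λ { refl → v∉X x∈X }

    module _ {k : ℕ} where

      -- The two kinds of image are told apart by `v ∈ Y`, because `f` takes its values inside
      -- `W -ᵛ v`.
      leaf-≼ : 2 ≤ k → ConnectedIn k (W -ᵛ v) ≼ Pointed k u (W -ᵛ v) → ConnectedIn k W ≼ Pointed k u W
      leaf-≼ 2≤k f = record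
        { rel = λ X Y → (v ∈ Y × X ≡ Y) ⊎ (¬ v ∈ Y × rel f X Y)
        ; total = tot
        ; injective = λ
          { (inj₁ (_ , refl)) (inj₁ (_ , refl)) → refl
          ; (inj₂ (_ , r))    (inj₂ (_ , r′))   → injective f r r′
          ; (inj₁ (v∈ , _))   (inj₂ (v∉ , _))   → contradiction v∈ v∉
          ; (inj₂ (v∉ , _))   (inj₁ (v∈ , _))   → contradiction v∈ v∉
          }
        }
        where
        tot : ∀ {X} → ConnectedIn k W X → ∃[ Y ] Pointed k u W Y × ((v ∈ Y × X ≡ Y) ⊎ (¬ v ∈ Y × rel f X Y))
        tot {X} (conn , X⊆W , |X|) with v ∈? X
        ... | yes v∈X = X
          , (leaf⇒support (connectedSet-sound G conn) X⊆W (subst (2 ≤_) (≡.sym |X|) 2≤k) v∈X , X⊆W , |X|)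
          , inj₁ (v∈X , refl)
        ... | no v∉X with total f (conn , avoid X⊆W v∉X , |X|)
        ... | Y , (u∈Y , Y⊆ , |Y|) , r = Y , (u∈Y , proj₁ ∘ ∈--ᵛ⁻ ∘ Y⊆ , |Y|) , inj₂ (∉--ᵛ ∘ Y⊆ , r)

      -- A connected set avoiding u is an interval of the path W − u; trading its two end points for u and v
      -- leaves a disconnected set, whose closed neighbourhood in the path gives the interval back.
      module Cycle (3≤k : 3 ≤ k) (cyc : CycleIn G (W -ᵛ v) u) where

        open CycleIn cyc

        Inner : Subset n → Fin n → Set
        Inner Y y = y ∈ Y × y ≢ u × y ≢ v

        InnerClosure : Subset n → Fin n → Set
        InnerClosure Y x = ∃[ y ] Inner Y y × (x ≡ y ⊎ NeighbourIn G (W -ᵛ v) y x)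

        -- Connectedness of `Y` tells the two kinds of image apart. In the second kind the two
        -- inclusions determine `X` from `Y` without mentioning its end points.
        Rel : Subset n → Subset n → Set
        Rel X Y = (T (connectedSet (adj G) Y) × X ≡ Y) ⊎
                  (¬ T (connectedSet (adj G) Y) × (∀ {x} → x ∈ X → InnerClosure Y x) × (∀ {x} → InnerClosure Y x → x ∈ X))

        rel-injective : ∀ {X X′ Y} → Rel X Y → Rel X′ Y → X ≡ X′
        rel-injective (inj₁ (_ , refl)) (inj₁ (_ , refl)) = refl
        rel-injective (inj₁ (c , _)) (inj₂ (¬c , _)) = contradiction c ¬c
        rel-injective (inj₂ (¬c , _)) (inj₁ (c , _)) = contradiction c ¬c
        rel-injective (inj₂ (_ , X⊆ , ⊆X)) (inj₂ (_ , X′⊆ , ⊆X′)) = ⊆-antisym (⊆X′ ∘ X⊆) (⊆X ∘ X′⊆)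

        module _ {X : Subset n} (conn : Connected G X) (X⊆W′ : X ⊆ W -ᵛ v) (|X| : size X ≡ k) (u∉X : ¬ u ∈ X) where

          p0∉X : ¬ p 0 ∈ X
          p0∉X = subst (λ x → ¬ x ∈ X) (≡.sym p-zero) u∉X

          3≤|X| : 3 ≤ size X
          3≤|X| = subst (3 ≤_) (≡.sym |X|) 3≤k

          index : ∀ {x} → x ∈ X → ∃[ i ] i < len × x ≡ p i
          index x∈X = cover (X⊆W′ x∈X)

          some : ∃[ i ] i < len × p i ∈ X
          some with inhabited X (≤-trans (s≤s z≤n) 3≤|X|)
          ... | x , x∈X with index x∈X
          ... | i , i<len , refl = i , i<len , x∈X

          lowest : ∃[ i ] p i ∈ X × (∀ {j} → j < i → ¬ p j ∈ X)
          lowest = least (λ i → p i ∈? X) (proj₂ (proj₂ some))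

          highest : ∃[ i ] i < len × p i ∈ X × (∀ {j} → i < j → j < len → ¬ p j ∈ X)
          highest = greatest (λ i → p i ∈? X) (proj₁ (proj₂ some)) (proj₂ (proj₂ some))

          lo hi : ℕ
          lo = proj₁ lowest
          hi = proj₁ highest

          lo∈X : p lo ∈ X
          lo∈X = proj₁ (proj₂ lowest)

          hi∈X : p hi ∈ X
          hi∈X = proj₁ (proj₂ (proj₂ highest))

          hi<len : hi < len
          hi<len = proj₁ (proj₂ highest)

          lo≤ : ∀ {i} → p i ∈ X → lo ≤ i
          lo≤ i∈X = ≮⇒≥ λ i<lo → proj₂ (proj₂ lowest) i<lo i∈X

          ≤hi : ∀ {i} → i < len → p i ∈ X → i ≤ hi
          ≤hi i<len i∈X = ≮⇒≥ λ hi<i → proj₂ (proj₂ (proj₂ highest)) hi<i i<len i∈X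

          lo<len : lo < len
          lo<len = ≤-<-trans (lo≤ hi∈X) hi<len

          between : ∀ {i} → i < len → p i ∈ X → p i ≢ p lo → p i ≢ p hi → lo < i × i < hi
          between i<len i∈X i≢lo i≢hi =
            ≤∧≢⇒< (lo≤ i∈X) (i≢lo ∘ ≡.sym ∘ cong p) , ≤∧≢⇒< (≤hi i<len i∈X) (i≢hi ∘ cong p)

          -- If `p j` were missing, the vertices with index below `j` would be closed under
          -- adjacency in `X`, containing `p lo` but not `p hi`.
          interval : ∀ {j} → lo < j → j < hi → p j ∈ X
          interval {j} lo<j j<hi with p j ∈? X
          ... | yes j∈X = j∈X
          ... | no j∉X = contradiction
            (conn (λ x → ∃[ i ] i < j × x ≡ p i) closed lo∈X hi∈X (lo , lo<j , refl))
            λ { (i , i<j , hi≡i) → <⇒≢ (<-trans i<j j<hi) (≡.sym (p-inj hi<len (<-trans (<-trans i<j j<hi) hi<len) hi≡i)) }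
            where
            closed : ∀ {x y} → x ∈ X → y ∈ X → Adj G x y → ∃[ i ] (i < j × x ≡ p i) → ∃[ i ] (i < j × y ≡ p i)
            -- Index 0 is `u`, so `X` cannot pass from low to high indices around the back of the
            -- cycle.
            closed x∈X y∈X xy (zero , _ , refl) = contradiction x∈X p0∉X
            closed x∈X y∈X xy (suc i , i<j , refl) with nbr-suc (X⊆W′ y∈X , xy)
            ... | inj₁ y≡pi   = i , <-trans (n<1+n i) i<j , y≡pi
            ... | inj₂ y≡p2+i with m≤n⇒m<n∨m≡n i<j
            ... | inj₁ 2+i<j = suc (suc i) , 2+i<j , y≡p2+i
            ... | inj₂ refl  = contradiction (subst (_∈ X) y≡p2+i y∈X) j∉X

          -- A third member lies strictly between the extremes. The nonempty interior allows the end
          -- points to be recovered as its neighbours, and separates it from `u` in the image.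
          middle : ∃[ i ] lo < i × i < hi
          middle with member-avoiding₂ X (p lo) (p hi) 3≤|X|
          ... | x , x∈X , x≢lo , x≢hi with index x∈X
          ... | i , i<len , refl = i , between i<len x∈X x≢lo x≢hi

          lo<hi : lo < hi
          lo<hi = let i , lo<i , i<hi = middle in <-trans lo<i i<hi

          plo≢phi : p lo ≢ p hi
          plo≢phi eq = <⇒≢ lo<hi (p-inj lo<len hi<len eq)

          -- Two successive exchanges, `p lo` for `u` and `p hi` for `v`, each of which preserves
          -- the size.
          Y : Subset n
          Y = X -ᵛ p lo +ᵛ u -ᵛ p hi +ᵛ v

          v∉X : ¬ v ∈ X
          v∉X = ∉--ᵛ ∘ X⊆W′

          ∈Y⁻ : ∀ {y} → y ∈ Y → y ≡ u ⊎ y ≡ v ⊎ (y ∈ X × y ≢ p lo × y ≢ p hi)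
          ∈Y⁻ y∈Y with ∈-+ᵛ⁻ y∈Y
          ... | inj₁ y≡v = inj₂ (inj₁ y≡v)
          ... | inj₂ y∈₁ with ∈--ᵛ⁻ y∈₁
          ... | y∈₂ , y≢hi with ∈-+ᵛ⁻ y∈₂
          ... | inj₁ y≡u = inj₁ y≡u
          ... | inj₂ y∈₃ with ∈--ᵛ⁻ y∈₃
          ... | y∈X , y≢lo = inj₂ (inj₂ (y∈X , y≢lo , y≢hi))

          u∈Y : u ∈ Y
          u∈Y = ⊆-+ᵛ (∈--ᵛ⁺ ∈-+ᵛ λ { u≡hi → u∉X (subst (_∈ X) (≡.sym u≡hi) hi∈X) })

          Y⊆W : Y ⊆ W
          Y⊆W y∈Y with ∈Y⁻ y∈Y
          ... | inj₁ refl = u∈W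
          ... | inj₂ (inj₁ refl) = v∈W
          ... | inj₂ (inj₂ (y∈X , _)) = proj₁ (∈--ᵛ⁻ (X⊆W′ y∈X))

          |Y| : size Y ≡ k
          |Y| = trans (size-exchange (X -ᵛ p lo +ᵛ u) (⊆-+ᵛ (∈--ᵛ⁺ hi∈X (plo≢phi ∘ ≡.sym)))
                  ([ u≢v ∘ ≡.sym , v∉X ∘ proj₁ ∘ ∈--ᵛ⁻ ]′ ∘ ∈-+ᵛ⁻))
                (trans (size-exchange X lo∈X u∉X) |X|)

          inner⁺ : ∀ {i} → lo < i → i < hi → Inner Y (p i)
          inner⁺ {i} lo<i i<hi = ⊆-+ᵛ (∈--ᵛ⁺ (⊆-+ᵛ (∈--ᵛ⁺ i∈X i≢lo)) i≢hi)
            , (λ i≡u → u∉X (subst (_∈ X) i≡u i∈X)) , λ i≡v → v∉X (subst (_∈ X) i≡v i∈X)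
            where
            i∈X = interval lo<i i<hi
            i≢lo : p i ≢ p lo
            i≢lo eq = <⇒≢ lo<i (≡.sym (p-inj (<-trans i<hi hi<len) lo<len eq))
            i≢hi : p i ≢ p hi
            i≢hi eq = <⇒≢ i<hi (p-inj (<-trans i<hi hi<len) hi<len eq)

          inner⁻ : ∀ {y} → Inner Y y → ∃[ i ] lo < i × i < hi × y ≡ p i
          inner⁻ (y∈Y , y≢u , y≢v) with ∈Y⁻ y∈Y
          ... | inj₁ y≡u = contradiction y≡u y≢u
          ... | inj₂ (inj₁ y≡v) = contradiction y≡v y≢v
          ... | inj₂ (inj₂ (y∈X , y≢lo , y≢hi)) with index y∈X
          ... | i , i<len , refl = let lo<i , i<hi = between i<len y∈X y≢lo y≢hi in i , lo<i , i<hi , refl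

          X-closed : ∀ {i} → lo ≤ i → i ≤ hi → p i ∈ X
          X-closed lo≤i i≤hi with m≤n⇒m<n∨m≡n lo≤i | m≤n⇒m<n∨m≡n i≤hi
          ... | inj₂ refl | _ = lo∈X
          ... | inj₁ _ | inj₂ refl = hi∈X
          ... | inj₁ lo<i | inj₁ i<hi = interval lo<i i<hi

          closure⁻ : ∀ {x} → InnerClosure Y x → x ∈ X
          closure⁻ {x} (y , inner , near) with inner⁻ inner
          -- An interior index exceeds `lo` and is therefore a successor, which makes `nbr-suc`
          -- applicable; its two neighbours cannot leave the range from `lo` to `hi`.
          ... | suc i , lo<1+i , 1+i<hi , refl with near
          ... | inj₁ refl = interval lo<1+i 1+i<hi
          ... | inj₂ yx with nbr-suc yx
          ... | inj₁ refl = X-closed (≤-pred lo<1+i) (<⇒≤ (<-trans (n<1+n i) 1+i<hi))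
          ... | inj₂ refl = X-closed (<⇒≤ (<-trans lo<1+i (n<1+n (suc i)))) 1+i<hi

          closure⁺ : ∀ {x} → x ∈ X → InnerClosure Y x
          closure⁺ {x} x∈X with x ≟ p lo | x ≟ p hi
          ... | yes refl | _ = p (suc lo)
            , inner⁺ ≤-refl (let i , lo<i , i<hi = middle in ≤-<-trans lo<i i<hi)
            , inj₂ (p∈W lo , Adj-sym G (p-adj lo))
          ... | no x≢lo | no x≢hi with index x∈X
          ... | i , i<len , refl = let lo<i , i<hi = between i<len x∈X x≢lo x≢hi in p i , inner⁺ lo<i i<hi , inj₁ refl
          closure⁺ {x} x∈X | no x≢lo | yes refl = before hi refl middle
            where
            -- `hi` is generalised to `h` to expose its predecessor, which is interior because some
            -- index lies strictly between `lo` and `h`.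
            before : ∀ h → h ≡ hi → ∃[ i ] (lo < i × i < h) → InnerClosure Y (p h)
            before (suc h) 1+h≡hi (i , lo<i , i<hi) =
              p h , inner⁺ (<-≤-trans lo<i (≤-pred i<hi)) (≤-reflexive 1+h≡hi) , inj₂ (p∈W (suc h) , p-adj h)

          -- Membership in `X` spreads along edges inside `Y`: path neighbours of the interior lie
          -- in `X`, and `v` is adjacent only to `u`. It holds on the interior and fails at `u`.
          disconnected : ¬ T (connectedSet (adj G) Y)
          disconnected connY with middle
          ... | i , lo<i , i<hi = u∉X
            (connectedSet-sound G connY (_∈ X) closed (proj₁ (inner⁺ lo<i i<hi)) u∈Y (interval lo<i i<hi))
            where
            closed : ∀ {x y} → x ∈ Y → y ∈ Y → Adj G x y → x ∈ X → y ∈ X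
            closed {x} {y} x∈Y y∈Y xy x∈X = closure⁻ (x , (x∈Y , x≢u , x≢v) , inj₂ (∈--ᵛ⁺ (Y⊆W y∈Y) y≢v , xy))
              where
              x≢u : x ≢ u
              x≢u refl = u∉X x∈X
              x≢v : x ≢ v
              x≢v refl = v∉X x∈X
              y≢v : y ≢ v
              y≢v refl = x≢u (leaf (Y⊆W x∈Y , Adj-sym G xy))

        cycle-≼ : ConnectedIn k W ≼ Pointed k u W
        cycle-≼ = record { rel = Rel ; total = tot ; injective = rel-injective }
          where
          tot : ∀ {X} → ConnectedIn k W X → ∃[ Y ] Pointed k u W Y × Rel X Y
          tot {X} (conn , X⊆W , |X|) with u ∈? X
          ... | yes u∈X = X , (u∈X , X⊆W , |X|) , inj₁ (conn , refl)
          ... | no u∉X = Y c X⊆ |X| u∉X , (u∈Y c X⊆ |X| u∉X , Y⊆W c X⊆ |X| u∉X , |Y| c X⊆ |X| u∉X)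
            , inj₂ (disconnected c X⊆ |X| u∉X , closure⁺ c X⊆ |X| u∉X , closure⁻ c X⊆ |X| u∉X)
            where
            c : Connected G X
            c = connectedSet-sound G conn
            X⊆ : X ⊆ W -ᵛ v
            X⊆ = avoid X⊆W λ v∈X → u∉X (leaf⇒support c X⊆W (subst (2 ≤_) (≡.sym |X|) (≤-trans (s≤s (s≤s z≤n)) 3≤k)) v∈X)

  -- The induction on leaves

  module _ (3≤k : 3 ≤ k) where

    -- Induction on the order `s`. The vertex `c` is arbitrary so that the recursive call can be
    -- made at the support `u`; `Pointed-≼` then moves the point to `c`.
    connectedIn≼pointed : ∀ s {W} → size W ≡ s → Connected G W → degreeSum G W ≤ size W + size W →
      ∃[ v ] v ∈ W × ¬ TwoNeighbours G W v → ∀ {c} → c ∈ W → ConnectedIn k W ≼ Pointed k c W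
    connectedIn≼pointed s {W} |W| conn D≤ (v , v∈W , ¬two) c∈W with any? (NeighbourIn? G W v)
    -- An isolated vertex is all of the connected set `W`, which leaves no room for three members.
    ... | no isolated = ≼-⊆ λ {X} (_ , X⊆W , |X|) →
      let x , x∈X , x≢v = member-avoiding₁ X v (subst (2 ≤_) (≡.sym |X|) (≤-trans (s≤s (s≤s z≤n)) 3≤k)) in
      contradiction (conn (_≡ v) (λ { _ y∈W vy refl → contradiction (_ , y∈W , vy) isolated }) v∈W (X⊆W x∈X) refl) x≢v
    connectedIn≼pointed zero {W} |W| _ _ (v , v∈W , _) _ | yes _ with trans (size--ᵛ W v v∈W) |W|
    ... | ()
    connectedIn≼pointed (suc s) {W} |W| conn D≤ (v , v∈W , ¬two) c∈W | yes (u , u∈W , vu) = ≼-trans toSupport (Pointed-≼ c∈W)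
      where
      W′ = W -ᵛ v
      leaf : ∀ {y} → NeighbourIn G W v y → y ≡ u
      leaf {y} vy with y ≟ u
      ... | yes y≡u = y≡u
      ... | no y≢u  = contradiction (y , u , y≢u , vy , u∈W , vu) ¬two
      open Leaf v∈W u∈W vu leaf
      u∈W′ : u ∈ W′
      u∈W′ = ∈--ᵛ⁺ u∈W u≢v
      -- Deleting `v` lowers the degree sum by at least two and twice the order by exactly two.
      D′≤ : degreeSum G W′ ≤ size W′ + size W′
      D′≤ = +-cancelˡ-≤ 2 _ _ (begin
        2 + degreeSum G W′               ≤⟨ degreeSum--ᵛ G v∈W u∈W vu ⟩
        degreeSum G W                    ≤⟨ D≤ ⟩
        size W + size W                  ≡⟨ cong (λ t → t + t) (size--ᵛ W v v∈W) ⟨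
        suc (size W′ + suc (size W′))    ≡⟨ cong suc (+-suc (size W′) (size W′)) ⟩
        2 + (size W′ + size W′)          ∎)
        where open ≤-Reasoning
      toSupport : ConnectedIn k W ≼ Pointed k u W
      toSupport with any? (λ x → (x ∈? W′) ×-dec ¬? (TwoNeighbours? G W′ x))
      ... | yes deficient = leaf-≼ (≤-trans (s≤s (s≤s z≤n)) 3≤k)
        (connectedIn≼pointed s (suc-injective (trans (size--ᵛ W v v∈W) |W|)) (Connected--ᵛ conn) D′≤ deficient u∈W′)
      ... | no regular = Cycle.cycle-≼ 3≤k (cycleIn G (Connected--ᵛ conn)
        (λ {x} x∈ → decidable-stable (TwoNeighbours? G W′ x) λ ¬two′ → regular (x , x∈ , ¬two′)) D′≤ u∈W′)

-- The graph Uₙ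

-- A record, so that the graph and the set can be inferred from the type; a bare `T` of a Boolean
-- does not determine them. `Reachable` below is wrapped for the same reason.
record ConnectedOfSize (k : ℕ) (A : Adjacency n) (X : Subset n) : Set where
  constructor connectedOfSize
  field
    isConnected : T (connectedSet A X)
    size≡       : size X ≡ k

open ConnectedOfSize

module _ (k : ℕ) (A : Adjacency n) where

  connectedOfSize⁻ : ∀ X → T (connectedSet A X ∧ (size X ≡ᵇ k)) → ConnectedOfSize k A X
  connectedOfSize⁻ X h = let c , s = Equivalence.to (T-∧ {connectedSet A X}) h in connectedOfSize c (≡ᵇ⇒≡ _ _ s)

  connectedOfSize⁺ : ∀ X → ConnectedOfSize k A X → T (connectedSet A X ∧ (size X ≡ᵇ k))
  connectedOfSize⁺ X (connectedOfSize c s) = Equivalence.from (T-∧ {connectedSet A X}) (c , ≡⇒≡ᵇ _ _ s)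

S-mono-≼ : (A B : Adjacency n) → ConnectedOfSize k A ≼ ConnectedOfSize k B → S k A ≤ S k B
S-mono-≼ {k = k} A B f = length-filter-≼ (λ X → T? (connectedSet A X ∧ (size X ≡ᵇ k))) (λ X → T? (connectedSet B X ∧ (size X ≡ᵇ k)))
  (≼-trans (≼-⊆ λ {X} → connectedOfSize⁻ k A X) (≼-trans f (≼-⊆ λ {X} → connectedOfSize⁺ k B X)))
  (subsets-unique _) ∈-subsets

record Reachable (A : Adjacency n) (X : Subset n) (m : ℕ) (a b : Fin n) : Set where
  constructor reachable
  field holds : T (reach A X m a b)

open Reachable

connectedSet-complete : (A : Adjacency n) (X : Subset n) {u : Fin n} → u ∈ X →
  (∀ {a b} → a ∈ X → b ∈ X → Reachable A X n a b) → T (connectedSet A X)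
connectedSet-complete {n} A X {u} u∈X walk = Equivalence.from (T-∧ {any (_∈ˢ X) (allFin n)})
  ( any⁺ (_∈ˢ X) (lose (∈-allFin u) (Equivalence.from T-≡ ([]=⇒lookup u∈X)))
  , all⁻ _ (tabulate⁺ λ a → guard a λ a∈ → all⁻ _ (tabulate⁺ λ b → guard b λ b∈ → holds (walk a∈ b∈))))
  where
  guard : ∀ a {q} → (a ∈ X → T q) → T (not (lookup X a) ∨ q)
  guard a f with lookup X a in eq
  ... | true  = f (lookup⇒[]= a X eq)
  ... | false = tt

module _ {A : Adjacency n} {X : Subset n} where

  reach-suc : ∀ {m a b} → Reachable A X m a b → Reachable A X (suc m) a b
  reach-suc {m} {a} {b} (reachable ab) = reachable (Equivalence.from (T-∨ {reach A X m a b}) (inj₁ ab))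

  reach-+ : ∀ {m a b} d → Reachable A X m a b → Reachable A X (d + m) a b
  reach-+ zero    ab = ab
  reach-+ (suc d) ab = reach-suc (reach-+ d ab)

  reach-refl : ∀ {m a} → Reachable A X m a a
  reach-refl {zero}  {a} = reachable (≡⇒≡ᵇ (toℕ a) (toℕ a) refl)
  reach-refl {suc m}     = reach-suc reach-refl

  reach-step : ∀ {m a b c} → Reachable A X m a b → b ∈ X → A b c ≡ true → Reachable A X (suc m) a c
  reach-step {m} {a} {b} {c} (reachable ab) b∈X bc =
    reachable (Equivalence.from (T-∨ {reach A X m a c}) (inj₂ (any⁺ _ (lose (∈-allFin b)
      (Equivalence.from (T-∧ {lookup X b}) (Equivalence.from T-≡ ([]=⇒lookup b∈X) ,
        Equivalence.from (T-∧ {reach A X m a b}) (ab , Equivalence.from T-≡ bc)))))))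

-- Pairs, and the coefficients of degree zero and one

size-⊥ : ∀ n → size {n} ∅ ≡ 0
size-⊥ zero    = refl
size-⊥ (suc n) = size-⊥ n

module _ (a b : Fin n) where

  pair : Subset n
  pair = ∅ +ᵛ a +ᵛ b

  a∈pair : a ∈ pair
  a∈pair = ⊆-+ᵛ ∈-+ᵛ

  b∈pair : b ∈ pair
  b∈pair = ∈-+ᵛ

  ∈-pair⁻ : ∀ {x} → x ∈ pair → x ≡ a ⊎ x ≡ b
  ∈-pair⁻ x∈ with ∈-+ᵛ⁻ x∈
  ... | inj₁ x≡b = inj₂ x≡b
  ... | inj₂ x∈′ = inj₁ ([ id , (λ x∈⊥ → contradiction x∈⊥ ∉⊥) ]′ (∈-+ᵛ⁻ x∈′))

  size-pair : a ≢ b → size pair ≡ 2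
  size-pair a≢b = trans (size-+ᵛ (∅ +ᵛ a) b ([ a≢b ∘ ≡.sym , ∉⊥ ]′ ∘ ∈-+ᵛ⁻))
    (cong suc (trans (size-+ᵛ ∅ a ∉⊥) (cong suc (size-⊥ n))))

singleton-connected : (A : Adjacency n) (X : Subset n) → size X ≡ 1 → T (connectedSet A X)
singleton-connected A X |X| with inhabited X (≤-reflexive (≡.sym |X|))
... | u , u∈X = connectedSet-complete A X u∈X λ {a} {b} a∈X b∈X →
  subst (Reachable A X _ a) (trans (≡u a∈X) (≡.sym (≡u b∈X))) reach-refl
  where
  ≡u : ∀ {x} → x ∈ X → x ≡ u
  ≡u {x} x∈X with x ≟ u
  ... | yes x≡u = x≡u
  ... | no x≢u with trans (cong suc (size--ᵛ (X -ᵛ u) x (∈--ᵛ⁺ x∈X x≢u))) (trans (size--ᵛ X u u∈X) |X|)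
  ... | ()

connectedSet-inhabited : (A : Adjacency n) (X : Subset n) → T (connectedSet A X) → ∃[ u ] u ∈ X
connectedSet-inhabited {n} A X conn =
  let u , u∈ = satisfied (any⁻ (_∈ˢ X) (allFin n) (proj₁ (Equivalence.to (T-∧ {any (_∈ˢ X) (allFin n)}) conn)))
  in u , lookup⇒[]= u X (Equivalence.to T-≡ u∈)

-- No set is counted on the left, since `connectedSet` demands a member.
S₀≤S₀ : (A B : Adjacency n) → S 0 A ≤ S 0 B
S₀≤S₀ A B = S-mono-≼ A B (≼-⊆ λ {X} (connectedOfSize conn |X|) → let u , u∈X = connectedSet-inhabited A X conn in
  contradiction (trans (size--ᵛ X u u∈X) |X|) λ ())

S₁≤S₁ : (A B : Adjacency n) → S 1 A ≤ S 1 B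
S₁≤S₁ A B = S-mono-≼ A B (≼-⊆ λ {X} (connectedOfSize _ |X|) → connectedOfSize (singleton-connected B X |X|) |X|)

module _ (n : ℕ) where

  private
    N : ℕ
    N = suc (suc (suc n))

    U : Adjacency N
    U = UAdj N

    1F 2F : Fin N
    1F = suc zero
    2F = suc (suc zero)

  U-hub : ∀ {x : Fin N} → x ≢ zero → U x zero ≡ true
  U-hub {zero}  x≢0 = contradiction refl x≢0
  U-hub {suc x} _   = refl

  U-spoke : ∀ {x : Fin N} → x ≢ zero → U zero x ≡ true
  U-spoke {zero}  x≢0 = contradiction refl x≢0
  U-spoke {suc x} _   = refl

  U-connected-hub : ∀ X → zero ∈ X → T (connectedSet U X)
  U-connected-hub X 0∈X = connectedSet-complete U X 0∈X λ {a} {b} a∈X b∈X →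
    -- Two steps through the hub suffice; the walk is padded to the length `N`, which is
    -- `2 + suc n`.
    subst (λ m → Reachable U X m a b) (+-comm (suc n) 2) (reach-+ (suc n) (walk a∈X))
    where
    toHub : ∀ {a} → a ∈ X → Reachable U X 1 a zero
    toHub {a} a∈X with a ≟ zero
    ... | yes a≡0 = subst (Reachable U X 1 a) a≡0 reach-refl
    ... | no a≢0  = reach-step reach-refl a∈X (U-hub a≢0)
    walk : ∀ {a b} → a ∈ X → Reachable U X 2 a b
    walk {a} {b} a∈X with b ≟ zero
    ... | yes b≡0 = subst (Reachable U X 2 a) (≡.sym b≡0) (reach-suc (toHub a∈X))
    ... | no b≢0  = reach-step (toHub a∈X) 0∈X (U-spoke b≢0)

  U-connected-side : T (connectedSet U (pair 1F 2F))
  U-connected-side = connectedSet-complete U (pair 1F 2F) (a∈pair 1F 2F) λ {a} {b} a∈ b∈ →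
    subst (λ m → Reachable U (pair 1F 2F) m a b) (+-comm (suc (suc n)) 1)
      (reach-+ (suc (suc n)) (walk a∈ (∈-pair⁻ 1F 2F a∈) (∈-pair⁻ 1F 2F b∈)))
    where
    walk : ∀ {a b} → a ∈ pair 1F 2F → a ≡ 1F ⊎ a ≡ 2F → b ≡ 1F ⊎ b ≡ 2F → Reachable U (pair 1F 2F) 1 a b
    walk a∈ (inj₁ refl) (inj₁ refl) = reach-refl
    walk a∈ (inj₁ refl) (inj₂ refl) = reach-step {b = 1F} reach-refl a∈ refl
    walk a∈ (inj₂ refl) (inj₁ refl) = reach-step {b = 2F} reach-refl a∈ refl
    walk a∈ (inj₂ refl) (inj₂ refl) = reach-refl

  -- Indexes the edges by the vertices: a vertex other than the hub stands for its spoke, and the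
  -- hub for the triangle side opposite to it.
  U-edge : Fin N → Subset N
  U-edge zero    = pair 1F 2F
  U-edge (suc x) = pair zero (suc x)

  U-edge-connectedOfSize : ∀ x → ConnectedOfSize 2 U (U-edge x)
  U-edge-connectedOfSize zero    = connectedOfSize U-connected-side (size-pair 1F 2F λ ())
  U-edge-connectedOfSize (suc x) =
    connectedOfSize (U-connected-hub (pair zero (suc x)) (a∈pair zero (suc x))) (size-pair zero (suc x) λ ())

  hub∉side : ¬ zero ∈ pair 1F 2F
  hub∉side 0∈ with ∈-pair⁻ 1F 2F 0∈
  ... | inj₁ ()
  ... | inj₂ ()

  U-edge-injective : ∀ x y → U-edge x ≡ U-edge y → x ≡ y
  U-edge-injective zero    zero    _  = refl
  U-edge-injective zero    (suc y) eq = contradiction (subst (zero ∈_) (≡.sym eq) (a∈pair zero (suc y))) hub∉side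
  U-edge-injective (suc x) zero    eq = contradiction (subst (zero ∈_) eq (a∈pair zero (suc x))) hub∉side
  U-edge-injective (suc x) (suc y) eq with ∈-pair⁻ zero (suc y) (subst (suc x ∈_) eq (b∈pair zero (suc x)))
  ... | inj₂ x≡y = x≡y

  n≤S₂-U : N ≤ S 2 U
  n≤S₂-U = subst (_≤ S 2 U) (length-tabulate {n = N} id) (length-injective {R = λ x X → X ≡ U-edge x}
    (λ { refl eq → U-edge-injective _ _ eq }) (Unique.allFin⁺ N)
    λ {x} _ → U-edge x , ∈-filter⁺ (λ X → T? (connectedSet U X ∧ (size X ≡ᵇ 2))) (∈-subsets (U-edge x))
      (connectedOfSize⁺ 2 U (U-edge x) (U-edge-connectedOfSize x)) , refl)

-- Connected pairs are edges

module _ {n : ℕ} (G : Graph n) where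

  -- `edgeCount` counts Booleans; here the same entries are kept as increasing pairs, which can
  -- serve as images of two-element sets.
  edges : List (Fin n × Fin n)
  edges = filter (T? ∘ uncurry (edge G)) (cartesianProduct (allFin n) (allFin n))

  length-filter-map : (f : A → Bool) → ∀ xs → length (filter T? (map f xs)) ≡ length (filter (T? ∘ f) xs)
  length-filter-map f [] = refl
  length-filter-map f (x ∷ xs) with f x
  ... | true  = cong suc (length-filter-map f xs)
  ... | false = length-filter-map f xs

  concatMap-cartesianProduct : (f : A → B → C) → ∀ xs ys →
    concatMap (λ x → map (f x) ys) xs ≡ map (uncurry f) (cartesianProduct xs ys)
  concatMap-cartesianProduct f [] ys = refl
  concatMap-cartesianProduct f (x ∷ xs) ys = begin
    map (f x) ys ++ concatMap (λ x → map (f x) ys) xs                        ≡⟨ cong₂ _++_ (map-∘ ys) (concatMap-cartesianProduct f xs ys) ⟩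
    map (uncurry f) (map (x ,_) ys) ++ map (uncurry f) (cartesianProduct xs ys) ≡⟨ map-++ (uncurry f) (map (x ,_) ys) _ ⟨
    map (uncurry f) (cartesianProduct (x ∷ xs) ys)                            ∎
    where open ≡.≡-Reasoning

  length-edges : length edges ≡ edgeCount G
  length-edges = ≡.sym (trans
    (cong (length ∘ filter T?) (concatMap-cartesianProduct (edge G) (allFin n) (allFin n)))
    (length-filter-map (uncurry (edge G)) (cartesianProduct (allFin n) (allFin n))))

  Ends : Subset n → Fin n × Fin n → Set
  Ends X (x , y) = x ≢ y × x ∈ X × y ∈ X × size X ≡ 2

  ends-member : ∀ {X x y z} → Ends X (x , y) → z ∈ X → z ≡ x ⊎ z ≡ y
  ends-member {X} {x} {y} {z} (x≢y , x∈X , y∈X , |X|) z∈X with z ≟ x | z ≟ y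
  ... | yes z≡x | _ = inj₁ z≡x
  ... | no _ | yes z≡y = inj₂ z≡y
  ... | no z≢x | no z≢y with trans (trans (cong (λ t → suc (suc t)) (size--ᵛ (X -ᵛ x -ᵛ y) z (∈--ᵛ⁺ (∈--ᵛ⁺ z∈X z≢x) z≢y)))
    (cong suc (size--ᵛ (X -ᵛ x) y (∈--ᵛ⁺ y∈X (x≢y ∘ ≡.sym))))) (trans (size--ᵛ X x x∈X) |X|)
  ... | ()

  ends-⊆ : ∀ {X X′ e} → Ends X e → Ends X′ e → X ⊆ X′
  ends-⊆ E E′@(_ , x∈X′ , y∈X′ , _) z∈X with ends-member E z∈X
  ... | inj₁ refl = x∈X′
  ... | inj₂ refl = y∈X′

  connectedPair⇒edge : ∀ {X} → ConnectedOfSize 2 (adj G) X → ∃[ e ] e ∈ₗ edges × Ends X e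
  connectedPair⇒edge {X} (connectedOfSize conn |X|)
    with inhabited X (subst (1 ≤_) (≡.sym |X|) (s≤s z≤n))
  ... | x , x∈X with member-avoiding₁ X x (≤-reflexive (≡.sym |X|))
  ... | y , y∈X , y≢x = orient (<-cmp (toℕ x) (toℕ y))
    where
    xy : Adj G x y
    xy with adj G x y Bool.≟ true
    ... | yes xy = xy
    -- Without the edge, `x` has no neighbour in `X`, so the property of being `x` would have to
    -- hold at `y`.
    ... | no ¬xy = contradiction (connectedSet-sound G conn (_≡ x) closed x∈X y∈X refl) y≢x
      where
      closed : ∀ {a b} → a ∈ X → b ∈ X → Adj G a b → a ≡ x → b ≡ x
      closed _ b∈X xb refl with ends-member (y≢x ∘ ≡.sym , x∈X , y∈X , |X|) b∈X
      ... | inj₁ b≡x  = b≡x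
      ... | inj₂ refl = contradiction xb ¬xy
    member : ∀ {x y} → toℕ x < toℕ y → Adj G x y → (x , y) ∈ₗ edges
    member {x} {y} x<y xy = ∈-filter⁺ (T? ∘ uncurry (edge G)) (∈-cartesianProduct⁺ (∈-allFin x) (∈-allFin y))
      (Equivalence.from T-≡ (∧-true⁺ (<ᵇ-true x<y) xy))
    orient : Tri (toℕ x < toℕ y) (toℕ x ≡ toℕ y) (toℕ y < toℕ x) → _
    orient (tri< x<y _ _) = (x , y) , member x<y xy , y≢x ∘ ≡.sym , x∈X , y∈X , |X|
    orient (tri≈ _ x≡y _) = contradiction (≡.sym (toℕ-injective x≡y)) y≢x
    orient (tri> _ _ y<x) = (y , x) , member y<x (Adj-sym G xy) , y≢x , y∈X , x∈X , |X|

  S₂≤edgeCount : S 2 (adj G) ≤ edgeCount G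
  S₂≤edgeCount = subst (S 2 (adj G) ≤_) length-edges (length-injective {R = Ends}
    (λ E E′ → ⊆-antisym (ends-⊆ E E′) (ends-⊆ E′ E)) (Unique.filter⁺ P? (subsets-unique n))
    λ X∈ → connectedPair⇒edge (connectedOfSize⁻ 2 (adj G) _ (proj₂ (∈-filter⁻ P? {xs = subsets n} X∈))))
    where
    P? : Decidable (λ X → T (connectedSet (adj G) X ∧ (size X ≡ᵇ 2)))
    P? X = T? _

-- The inequality for each coefficient

theorem3p4 : (n : ℕ) → 5 ≤ n → (G : Graph n) → Unicyclic G →
    ¬ IsomorphicTo G (cycleAdj n) →
    (k : ℕ) → S k (adj G) ≤ S k (UAdj n)
theorem3p4 n 5≤n G _ _ 0 = S₀≤S₀ (adj G) (UAdj n)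
theorem3p4 n 5≤n G _ _ 1 = S₁≤S₁ (adj G) (UAdj n)
theorem3p4 (suc zero) (s≤s ()) _ _ _ (suc (suc _))
theorem3p4 (suc (suc zero)) (s≤s (s≤s ())) _ _ _ (suc (suc _))
theorem3p4 (suc (suc (suc n))) 5≤n G (_ , |E|) _ 2 =
  ≤-trans (S₂≤edgeCount G) (≤-trans (≤-reflexive |E|) (n≤S₂-U n))
theorem3p4 N@(suc (suc (suc n))) 5≤n G (conn , |E|) ≇C k@(suc (suc (suc _))) = S-mono-≼ (adj G) (UAdj N)
  -- The chosen point is vertex 0, the hub of the target graph, so every pointed set is connected
  -- there.
  (≼-trans (≼-⊆ λ { (connectedOfSize c |X|) → c , (λ {x} _ → ∈-full x) , |X| })
  (≼-trans (connectedIn≼pointed G {k} (s≤s (s≤s (s≤s z≤n))) N (size-full N) connected D≤ deficient (∈-full zero))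
  (≼-⊆ λ { {X} (0∈X , _ , |X|) → connectedOfSize (U-connected-hub n X 0∈X) |X| })))
  where
  connected : Connected G (full N)
  connected = connectedSet-sound G conn
  D≤ : degreeSum G (full N) ≤ size (full N) + size (full N)
  D≤ = ≤-reflexive (trans (degreeSum-full G) (cong (λ t → t + t) (trans |E| (≡.sym (size-full N)))))
  -- If every vertex had two neighbours, the degree bound would make the whole graph a cycle,
  -- against the assumption on `G`.
  deficient : ∃[ v ] v ∈ full N × ¬ TwoNeighbours G (full N) v
  deficient with any? (λ x → (x ∈? full N) ×-dec ¬? (TwoNeighbours? G (full N) x))
  ... | yes v = v
  ... | no regular = contradiction (isomorphicToCycle G (cycleIn G connected
    (λ {x} x∈ → decidable-stable (TwoNeighbours? G (full N) x) λ ¬two → regular (x , x∈ , ¬two)) D≤ (∈-full zero))) ≇C
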